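{- Let $n\ge 2$ and $k\ge 0$, and fix any linear order on the edges of the braid gain graph $B_n$. The number of NBC bases of $B_n$ of activity $k$ is equal to each of the following: (1) the number of increasing rooted labeled trees on the vertex set $[n]$ in which vertex $1$ has degree $k$; (2) the number of decreasing rooted labeled trees on $[n]$ in which vertex $n$ has degree $k$; (3) the number of decreasing rooted labeled trees on $[n]$ having exactly $k$ edges of the form $(i+1,i)$, i.e. edges whose parent is $i+1$ and whose child is $i$; (4) $(-1)^{n-1-k}s(n-1,k)$, the unsigned Stirling number of the first kind (the number of permutations of $[n-1]$ with exactly $k$ cycles).
   Context: The braid gain graph $B_n$ has vertex set $[n]=\{1,\dots,n\}$ and, for each $1\le i<j\le n$, one edge $\{i,j\}$ with gain $0$ (corresponding to the hyperplane $x_j-x_i=0$); every circle is balanced (has gain $0$). Given a linear order on the edge set, a broken circuit is the edge set of a balanced circle with its smallest edge removed; an NBC set is a set of edges forming a forest that contains no broken circuit; an NBC basis is an NBC set that is a spanning tree. For a spanning tree $B$ and $e\in B$, $e$ is (interiorly) active in $B$ if $e$ is the smallest element of the fundamental cocircuit $C^*(B,e)$, i.e. of the set of edges $f$ such that $(B\setminus\{e\})\cup\{f\}$ is a spanning tree; the activity of $B$ is the number of its active elements. A rooted labeled tree on $[n]$ is increasing (resp. decreasing) if every vertex has a smaller (resp. larger) label than each of its children; thus vertex $1$ (resp. $n$) is the root, and its degree is its number of children. $s(m,k)$ denotes the signed Stirling number of the first kind. -}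

module Defs where

open import Data.Nat as ℕ using (ℕ; zero; suc; _∸_)
open import Data.Fin using (Fin; toℕ) renaming (_<_ to _<ᶠ_)
open import Data.Bool using (Bool; true; false)
open import Data.Vec using (Vec; lookup)
open import Data.List using (List; []; _∷_; _++_; [_]; zip; length)
open import Data.List.Membership.Propositional using (_∈_)
open import Data.List.Relation.Unary.Unique.Propositional using (Unique)
open import Data.Product using (Σ; ∃; _×_; _,_)
open import Data.Sum using (_⊎_)
open import Data.Integer as ℤ using (ℤ; +_; -1ℤ)
open import Relation.Nullary using (¬_)
open import Relation.Binary.PropositionalEquality using (_≡_; _≢_)
open import Relation.Binary.Structures using (IsStrictTotalOrder)
open import Function.Bundles using (_⇔_)

HasCard : {A : Set} → (A → Set) → ℕ → Set
HasCard {A} P m =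
  Σ (List A) λ L → Unique L × (∀ x → (x ∈ L) ⇔ P x) × (length L ≡ m)

-- The braid gain graph B_n.  Vertex t : Fin n stands for label toℕ t + 1.
-- Edges: {i,j} with i < j (gain 0).  All circles are balanced.

record Edge (n : ℕ) : Set where
  constructor mkEdge
  field
    lo  : Fin n
    hi  : Fin n
    lo<hi : lo <ᶠ hi
open Edge public

EdgeOrder : ℕ → Set₁
EdgeOrder n = Σ (Edge n → Edge n → Set) λ _≺_ → IsStrictTotalOrder _≡_ _≺_

EdgePred : ℕ → Set₁
EdgePred n = Edge n → Set

Adj : ∀ {n} → EdgePred n → Fin n → Fin n → Set
Adj {n} E u w = Σ (Edge n) λ e → E e ×
  ((lo e ≡ u × hi e ≡ w) ⊎ (lo e ≡ w × hi e ≡ u))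

data Walk {n : ℕ} (E : EdgePred n) : Fin n → Fin n → Set where
  here : ∀ {u} → Walk E u u
  step : ∀ {u w v} → Adj E u w → Walk E w v → Walk E u v

Connected : ∀ {n} → EdgePred n → Set
Connected E = ∀ u v → Walk E u v

-- Circles (of B_n, i.e. of the complete graph K_n): cyclic sequences of
-- at least 3 distinct vertices.
IsCircle : ∀ {n} → List (Fin n) → Set
IsCircle vs = Unique vs × (3 ℕ.≤ length vs)

rot : ∀ {A : Set} → List A → List A
rot []       = []
rot (x ∷ xs) = xs ++ [ x ]

cycPairs : ∀ {A : Set} → List A → List (A × A)
cycPairs vs = zip vs (rot vs)

EdgeOfCircle : ∀ {n} → List (Fin n) → Edge n → Set
EdgeOfCircle vs e = ((lo e , hi e) ∈ cycPairs vs) ⊎ ((hi e , lo e) ∈ cycPairs vs)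

IsForest : ∀ {n} → EdgePred n → Set
IsForest {n} E = ∀ (vs : List (Fin n)) → IsCircle vs →
  ¬ (∀ e → EdgeOfCircle vs e → E e)

IsSpanningTree : ∀ {n} → EdgePred n → Set
IsSpanningTree E = IsForest E × Connected E

ContainsBrokenCircuit : ∀ {n} → EdgeOrder n → EdgePred n → Set
ContainsBrokenCircuit {n} (_≺_ , _) E =
  Σ (List (Fin n)) λ vs → IsCircle vs × Σ (Edge n) λ e₀ →
    EdgeOfCircle vs e₀ ×
    (∀ e → EdgeOfCircle vs e → e ≢ e₀ → e₀ ≺ e) ×
    (∀ e → EdgeOfCircle vs e → e ≢ e₀ → E e)

IsNBCSet : ∀ {n} → EdgeOrder n → EdgePred n → Set
IsNBCSet o E = IsForest E × ¬ ContainsBrokenCircuit o E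

IsNBCBasis : ∀ {n} → EdgeOrder n → EdgePred n → Set
IsNBCBasis o E = IsNBCSet o E × IsSpanningTree E

exchange : ∀ {n} → EdgePred n → Edge n → Edge n → EdgePred n
exchange B e f g = (B g × g ≢ e) ⊎ (g ≡ f)

InCocircuit : ∀ {n} → EdgePred n → Edge n → Edge n → Set
InCocircuit B e f = IsSpanningTree (exchange B e f)

IsActive : ∀ {n} → EdgeOrder n → EdgePred n → Edge n → Set
IsActive (_≺_ , _) B e =
  B e × InCocircuit B e e × (∀ f → InCocircuit B e f → f ≢ e → e ≺ f)

-- Concrete edge sets (the objects being counted): upper triangular
-- Boolean matrices; entry (i,j) with i < j is true iff {i,j} is present.

EdgeMatrix : ℕ → Set
EdgeMatrix n = Vec (Vec Bool n) n

WellFormedEM : ∀ {n} → EdgeMatrix n → Set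
WellFormedEM S = ∀ i j → ¬ (i <ᶠ j) → lookup (lookup S i) j ≡ false

toPred : ∀ {n} → EdgeMatrix n → EdgePred n
toPred S e = lookup (lookup S (lo e)) (hi e) ≡ true

NBCBasisOfActivity : ∀ {n} → EdgeOrder n → ℕ → EdgeMatrix n → Set
NBCBasisOfActivity o k S =
  WellFormedEM S × IsNBCBasis o (toPred S) × HasCard (IsActive o (toPred S)) k

-- Rooted labeled trees on [n], given by a root r and a parent vector P
-- (P[r] = r by convention); every vertex reaches r by iterating P.

RTreeData : ℕ → Set
RTreeData n = Fin n × Vec (Fin n) n

iter : ∀ {A : Set} → (A → A) → ℕ → A → A
iter f zero    x = x
iter f (suc t) x = f (iter f t x)

IsRootedTree : ∀ {n} → RTreeData n → Set
IsRootedTree (r , P) =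
  lookup P r ≡ r × (∀ v → ∃ λ t → iter (lookup P) t v ≡ r)

IsChild : ∀ {n} → RTreeData n → Fin n → Fin n → Set
IsChild (r , P) v c = c ≢ r × lookup P c ≡ v

IsIncreasing : ∀ {n} → RTreeData n → Set
IsIncreasing T = IsRootedTree T × (∀ v c → IsChild T v c → v <ᶠ c)

IsDecreasing : ∀ {n} → RTreeData n → Set
IsDecreasing T = IsRootedTree T × (∀ v c → IsChild T v c → c <ᶠ v)

ChildrenOfLabel : ∀ {n} → RTreeData n → ℕ → Fin n → Set
ChildrenOfLabel T ℓ c = Σ _ λ v → suc (toℕ v) ≡ ℓ × IsChild T v c

IncRootDeg : ∀ {n} → ℕ → RTreeData n → Set
IncRootDeg k T = IsIncreasing T × HasCard (ChildrenOfLabel T 1) k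

DecRootDeg : ∀ n → ℕ → RTreeData n → Set
DecRootDeg n k T = IsDecreasing T × HasCard (ChildrenOfLabel T n) k

IsDescentEdgeChild : ∀ {n} → RTreeData n → Fin n → Set
IsDescentEdgeChild T c = Σ _ λ v → IsChild T v c × toℕ v ≡ suc (toℕ c)

DecAdjEdges : ∀ {n} → ℕ → RTreeData n → Set
DecAdjEdges k T = IsDecreasing T × HasCard (IsDescentEdgeChild T) k

stirling1 : ℕ → ℕ → ℤ
stirling1 zero    zero    = + 1
stirling1 zero    (suc k) = + 0
stirling1 (suc m) zero    = + 0
stirling1 (suc m) (suc k) = stirling1 m k ℤ.- (+ m) ℤ.* stirling1 m (suc k)

unsignedStirlingExpr : ℕ → ℕ → ℤ
unsignedStirlingExpr n k = (-1ℤ ℤ.^ (n ∸ 1 ∸ k)) ℤ.* stirling1 (n ∸ 1) k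

{-# OPTIONS --safe #-}

-- Scan the edges from the largest to the smallest and decide which ones to put into B. Then B is an
-- NBC basis iff no edge f, chosen or not, has its ends joined by the edges of B larger than f, and
-- the chosen edges finally connect everything; an edge e of such a B is active iff its ends are not
-- joined by the larger edges of B together with all smaller edges. Hence the generating polynomial of
-- activities is computed by deletion and contraction, processing the edges in the given order. By the
-- exchange property two consecutive edges may be swapped, so the polynomial does not depend on the
-- order. When the edges at the last vertex of the complete graph come first, it equals
-- x (x + 1) ⋯ (x + n − 2): two chosen edges at that vertex make an edge between earlier vertices a
-- loop, so exactly one is chosen, and only the last one of them has weight x.
--
-- In a decreasing tree the parents of the n − 1 other vertices are chosen independently, which gives
-- the same product for both statistics; relabelling i ↦ n + 1 − i turns decreasing into increasing.

module Submission where

open import Defs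
open import Data.Bool using (Bool; true; false)
open import Data.Empty using (⊥; ⊥-elim)
open import Data.Fin as Fin using (Fin; zero; suc; toℕ; fromℕ; fromℕ<; opposite; punchIn; punchOut)
import Data.Fin.Properties as Finₚ
open import Data.Integer as ℤ using (+_; -1ℤ)
import Data.Integer.Properties as ℤₚ
import Data.Integer.Solver as ℤSolver
open import Data.List using (List; []; _∷_; _++_; [_]; map; length; zip; allFin; filter; cartesianProduct)
import Data.List.Properties as Listₚ
import Data.List.Membership.DecPropositional as DecMembership
open import Data.List.Membership.Propositional using (_∈_; _∉_)
open import Data.List.Membership.Propositional.Properties
open import Data.List.Membership.Propositional.Properties.WithK using (unique∧set⇒bag)
open import Data.List.Relation.Binary.BagAndSetEquality using (∼bag⇒↭)
open import Data.List.Relation.Binary.Permutation.Propositional as Perm using (_↭_; ↭⇒↭ₛ)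
open import Data.List.Relation.Binary.Permutation.Propositional.Properties as Permₚ using (∈-resp-↭; ↭-length)
import Data.List.Relation.Binary.Permutation.Setoid.Properties as PermSetoidₚ
open import Data.List.Relation.Binary.Subset.Propositional using (_⊆_)
import Data.List.Relation.Binary.Subset.Propositional.Properties as ⊆ₚ
open import Data.List.Relation.Unary.All as All using (All; []; _∷_)
import Data.List.Relation.Unary.All.Properties as Allₚ
open import Data.List.Relation.Unary.AllPairs using (AllPairs; []; _∷_)
open import Data.List.Relation.Unary.Any using (here; there)
open import Data.List.Relation.Unary.Unique.Propositional using (Unique)
import Data.List.Relation.Unary.Unique.Propositional.Properties as Uniqueₚ
open import Data.Nat using (ℕ; zero; suc; _+_; _*_; _∸_; _≤_; _<_; s≤s; z≤n)
import Data.Nat.Properties as ℕₚ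
open import Data.Nat.Solver using (module +-*-Solver)
open import Data.Product using (Σ; ∃; ∃₂; _×_; _,_; proj₁; proj₂)
import Data.Product.Properties as Productₚ
open import Data.Sum as Sum using (_⊎_; inj₁; inj₂)
open import Data.Unit using (⊤; tt)
open import Data.Vec as Vec using (Vec; []; _∷_; lookup; tabulate)
import Data.Vec.Properties as Vecₚ
open import Function using (_∘_; id)
open import Function.Bundles using (_⇔_; mk⇔; Equivalence)
open import Function.Construct.Composition using (_⇔-∘_)
open import Function.Construct.Symmetry using (⇔-sym)
open import Relation.Binary.Definitions using (tri<; tri≈; tri>)
open import Relation.Binary.PropositionalEquality
  using (_≡_; _≢_; refl; sym; trans; cong; cong₂; subst; subst₂; _≗_; module ≡-Reasoning; setoid)
open import Relation.Binary.Structures using (IsStrictTotalOrder)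
open import Relation.Nullary using (¬_; Dec; yes; no; contradiction)
open import Relation.Nullary.Decidable using (map′; _⊎-dec_; _×-dec_; ¬?)

open Equivalence using (to; from)

-- No bijection between bases underlies the independence of the order: the set of NBC bases itself
-- changes with the order, and only the polynomial survives. The argument therefore works with
-- polynomials, namely with the Tutte polynomial at y = 0, since NBC bases are the bases without
-- externally active edges. During the scan the next test depends only on the pair of the chosen
-- larger edges `S` and the unread smaller edges `L`, so the polynomial is indexed by this pair;
-- only then can two neighbouring edges be compared in the middle of a scan.
--
-- The definitions speak of circles as cyclic vertex lists, whereas deletion and contraction needs a
-- closure operator. Walks mediate: a loop-erased walk around an edge closes up to a circle, and a
-- circle, rotated to one of its edges, is a walk around that edge.

private variable
  A B : Set
  P Q : A → Set
  m n k : ℕ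

-- Cardinalities

-- Degrees and activities occur inside the counted predicates as `HasCard _ k`; this turns such a
-- condition into an equation with a computed number.
HasCard-unique : HasCard P m → HasCard P n → m ≡ n
HasCard-unique (xs , xs! , ∈xs , refl) (ys , ys! , ∈ys , refl) =
  ↭-length (∼bag⇒↭ (unique∧set⇒bag xs! ys! λ {x} → ⇔-sym (∈ys x) ⇔-∘ ∈xs x))

map-Unique : ∀ {f : A → B} {xs} →
             (∀ {x y} → x ∈ xs → y ∈ xs → f x ≡ f y → x ≡ y) → Unique xs → Unique (map f xs)
map-Unique inj []           = []
map-Unique inj (x∉xs ∷ xs!) =
  Allₚ.map⁺ (All.tabulate λ y∈ fx≡fy → All.lookup x∉xs y∈ (inj (here refl) (there y∈) fx≡fy))
  ∷ map-Unique (λ x∈ y∈ → inj (there x∈) (there y∈)) xs!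

HasCard-bij : (f : A → B) →
              (∀ x → P x → Q (f x)) →
              (∀ {x y} → P x → P y → f x ≡ f y → x ≡ y) →
              (∀ y → Q y → ∃ λ x → P x × f x ≡ y) →
              HasCard P m → HasCard Q m
HasCard-bij {Q = Q} f pres inj surj (xs , xs! , ∈xs , len) =
    map f xs
  , map-Unique (λ x∈ y∈ → inj (to (∈xs _) x∈) (to (∈xs _) y∈)) xs!
  , (λ y → mk⇔ sound (complete y))
  , trans (Listₚ.length-map f xs) len
  where
  sound : ∀ {y} → y ∈ map f xs → Q y
  sound y∈ with ∈-map⁻ f y∈
  ... | x , x∈ , refl = pres x (to (∈xs x) x∈)
  complete : ∀ y → Q y → y ∈ map f xs
  complete y Qy with surj y Qy
  ... | x , Px , refl = ∈-map⁺ f (from (∈xs x) Px)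

HasCard-cong : (∀ x → P x ⇔ Q x) → HasCard P m → HasCard Q m
HasCard-cong P⇔Q (xs , xs! , ∈xs , len) = xs , xs! , (λ x → P⇔Q x ⇔-∘ ∈xs x) , len

HasCard-∅ : (∀ x → ¬ P x) → HasCard P 0
HasCard-∅ ¬P = [] , [] , (λ x → mk⇔ (λ ()) (⊥-elim ∘ ¬P x)) , refl

HasCard-singleton : (x : A) → P x → (∀ y → P y → y ≡ x) → HasCard P 1
HasCard-singleton x Px !x =
  [ x ] , [] ∷ [] , (λ y → mk⇔ (λ { (here refl) → Px }) (here ∘ !x y)) , refl

HasCard-⊎ : (∀ x → P x → Q x → ⊥) → HasCard P m → HasCard Q n → HasCard (λ x → P x ⊎ Q x) (m + n)
HasCard-⊎ {P = P} {Q = Q} disj (xs , xs! , ∈xs , refl) (ys , ys! , ∈ys , refl) =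
    xs ++ ys
  , Uniqueₚ.++⁺ xs! ys! (λ { (x∈ , y∈) → disj _ (to (∈xs _) x∈) (to (∈ys _) y∈) })
  , (λ x → mk⇔ sound complete)
  , Listₚ.length-++ xs
  where
  sound : ∀ {x} → x ∈ xs ++ ys → P x ⊎ Q x
  sound x∈ with ∈-++⁻ xs x∈
  ... | inj₁ x∈xs = inj₁ (to (∈xs _) x∈xs)
  ... | inj₂ x∈ys = inj₂ (to (∈ys _) x∈ys)
  complete : ∀ {x} → P x ⊎ Q x → x ∈ xs ++ ys
  complete (inj₁ Px) = ∈-++⁺ˡ (from (∈xs _) Px)
  complete (inj₂ Qx) = ∈-++⁺ʳ xs (from (∈ys _) Qx)

length-cartesianProduct : (xs : List A) (ys : List B) →
                          length (cartesianProduct xs ys) ≡ length xs * length ys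
length-cartesianProduct []       ys = refl
length-cartesianProduct (x ∷ xs) ys =
  trans (Listₚ.length-++ (map (x ,_) ys))
        (cong₂ _+_ (Listₚ.length-map (x ,_) ys) (length-cartesianProduct xs ys))

HasCard-× : HasCard P m → HasCard Q n → HasCard (λ (x , y) → P x × Q y) (m * n)
HasCard-× (xs , xs! , ∈xs , refl) (ys , ys! , ∈ys , refl) =
    cartesianProduct xs ys
  , Uniqueₚ.cartesianProduct⁺ xs! ys!
  , (λ (x , y) → mk⇔
      (λ xy∈ → let x∈ , y∈ = ∈-cartesianProduct⁻ xs ys xy∈ in to (∈xs x) x∈ , to (∈ys y) y∈)
      (λ (Px , Qy) → ∈-cartesianProduct⁺ (from (∈xs x) Px) (from (∈ys y) Qy)))
  , length-cartesianProduct xs ys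

HasCard-≢ : (i : Fin (suc n)) → HasCard (_≢ i) n
HasCard-≢ {n} i =
    map (punchIn i) (allFin n)
  , Uniqueₚ.map⁺ (Finₚ.punchIn-injective i _ _) (Uniqueₚ.allFin⁺ n)
  , (λ j → mk⇔ sound (complete j))
  , trans (Listₚ.length-map (punchIn i) (allFin n)) (Listₚ.length-tabulate id)
  where
  sound : ∀ {j} → j ∈ map (punchIn i) (allFin n) → j ≢ i
  sound j∈ with ∈-map⁻ (punchIn i) j∈
  ... | j′ , _ , refl = Finₚ.punchInᵢ≢i i j′
  complete : ∀ j → j ≢ i → j ∈ map (punchIn i) (allFin n)
  complete j j≢i = subst (_∈ map (punchIn i) (allFin n)) (Finₚ.punchIn-punchOut (j≢i ∘ sym))
                         (∈-map⁺ (punchIn i) (∈-allFin (punchOut (j≢i ∘ sym))))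

-- Rising factorials and Stirling numbers

-- Polynomials are represented by their coefficient functions; `x·` multiplies by the variable.
Poly : Set
Poly = ℕ → ℕ

x· : Poly → Poly
x· p zero    = 0
x· p (suc k) = p k

x·-cong : ∀ {p q : Poly} → p ≗ q → x· p ≗ x· q
x·-cong p≗q zero    = refl
x·-cong p≗q (suc k) = p≗q k

δ : Poly
δ zero    = 1
δ (suc _) = 0

-- x (x + 1) ⋯ (x + m − 1)
rising : ℕ → Poly
rising zero    = δ
rising (suc m) k = m * rising m k + x· (rising m) k

rising-suc-zero : ∀ m → rising (suc m) 0 ≡ 0
rising-suc-zero zero    = refl
rising-suc-zero (suc m) rewrite rising-suc-zero m = cong (_+ 0) (ℕₚ.*-zeroʳ m)

stirling1-> : ∀ {m k} → m < k → stirling1 m k ≡ + 0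
stirling1-> {zero}  {suc k} _ = refl
stirling1-> {suc m} {suc k} (s≤s m<k)
  rewrite stirling1-> m<k | stirling1-> (ℕₚ.m<n⇒m<1+n m<k) | ℤₚ.*-zeroʳ (+ m) = refl

-- Both sides obey the same recursion up to sign: the exponent `suc m ∸ suc k` is `m ∸ k`, so one
-- summand keeps its sign, and the minus sign of the other accounts for its exponent being one less.
rising≡stirling : ∀ m k → + (rising m k) ≡ (-1ℤ ℤ.^ (m ∸ k)) ℤ.* stirling1 m k
rising≡stirling zero    zero    = refl
rising≡stirling zero    (suc k) = refl
rising≡stirling (suc m) zero    =
  trans (cong +_ (rising-suc-zero m)) (sym (ℤₚ.*-zeroʳ (-1ℤ ℤ.^ suc m)))
rising≡stirling (suc m) (suc k) = begin
  + (m * rising m (suc k) + rising m k)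
    ≡⟨ ℤₚ.+-comm (+ (m * rising m (suc k))) (+ rising m k) ⟩
  + rising m k ℤ.+ + (m * rising m (suc k))
    ≡⟨ cong₂ ℤ._+_ (rising≡stirling m k) sign ⟩
  σ ℤ.* stirling1 m k ℤ.+ σ ℤ.* (ℤ.- (+ m ℤ.* stirling1 m (suc k)))
    ≡⟨ ℤₚ.*-distribˡ-+ σ (stirling1 m k) _ ⟨
  σ ℤ.* (stirling1 m k ℤ.- + m ℤ.* stirling1 m (suc k))
    ∎
  where
  open ≡-Reasoning
  σ = -1ℤ ℤ.^ (m ∸ k)
  sign : + (m * rising m (suc k)) ≡ σ ℤ.* (ℤ.- (+ m ℤ.* stirling1 m (suc k)))
  -- Only for `k < m` does the truncated exponent drop by one when `k` grows by one. Otherwise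
  -- `stirling1 m (suc k)` is zero and so are both sides.
  sign with k ℕₚ.<? m
  ... | yes k<m rewrite ℕₚ.+-∸-assoc 1 k<m = begin
    + (m * rising m (suc k))
      ≡⟨ ℤₚ.pos-* m (rising m (suc k)) ⟩
    + m ℤ.* + rising m (suc k)
      ≡⟨ cong (+ m ℤ.*_) (rising≡stirling m (suc k)) ⟩
    + m ℤ.* (τ ℤ.* s)
      ≡⟨ solve 3 (λ a b c → a :* (b :* c) := (con -1ℤ :* b) :* (:- (a :* c))) refl (+ m) τ s ⟩
    (-1ℤ ℤ.* τ) ℤ.* (ℤ.- (+ m ℤ.* s))
      ∎
    where
    open ℤSolver.+-*-Solver
    τ = -1ℤ ℤ.^ (m ∸ suc k)
    s = stirling1 m (suc k)
  ... | no k≮m = begin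
    + (m * rising m (suc k))
      ≡⟨ ℤₚ.pos-* m (rising m (suc k)) ⟩
    + m ℤ.* + rising m (suc k)
      ≡⟨ cong (+ m ℤ.*_) (trans (rising≡stirling m (suc k)) (trans (cong (τ ℤ.*_) s≡0) (ℤₚ.*-zeroʳ τ))) ⟩
    + m ℤ.* + 0
      ≡⟨ ℤₚ.*-zeroʳ (+ m) ⟩
    + 0
      ≡⟨ ℤₚ.*-zeroʳ σ ⟨
    σ ℤ.* (ℤ.- + 0)
      ≡⟨ cong (λ z → σ ℤ.* (ℤ.- z)) (trans (cong (+ m ℤ.*_) s≡0) (ℤₚ.*-zeroʳ (+ m))) ⟨
    σ ℤ.* (ℤ.- (+ m ℤ.* stirling1 m (suc k)))
      ∎
    where
    τ = -1ℤ ℤ.^ (m ∸ suc k)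
    s≡0 : stirling1 m (suc k) ≡ + 0
    s≡0 = stirling1-> (s≤s (ℕₚ.≮⇒≥ k≮m))

-- Increasing and decreasing trees

bump : Dec A → ℕ → ℕ
bump (yes _) k = suc k
bump (no  _) k = k

-- The head of a `Choices (suc m)` is the parent of the smallest vertex, taken among the `suc m`
-- larger ones; the tail describes the tree that is left when this leaf is removed.
Choices : ℕ → Set
Choices zero    = ⊤
Choices (suc m) = Fin (suc m) × Choices m

-- One distinguished parent per vertex covers both statistics: the largest candidate `fromℕ` is the
-- root, and the smallest candidate `zero` is the next larger label.
specials : (∀ m → Fin (suc m)) → Choices m → ℕ
specials {zero}  sp _       = 0
specials {suc m} sp (q , c) = bump (q Fin.≟ sp m) (specials sp c)

card-Choices : ∀ (sp : ∀ m → Fin (suc m)) m k → HasCard (λ (c : Choices m) → specials sp c ≡ k) (rising m k)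
card-Choices sp zero zero    = HasCard-singleton tt refl (λ _ _ → refl)
card-Choices sp zero (suc k) = HasCard-∅ (λ _ ())
card-Choices sp (suc m) k =
  HasCard-cong (λ (q , c) → split q c)
    (HasCard-⊎ (λ _ (q≢ , _) (q≡ , _) → q≢ q≡)
      (HasCard-× (HasCard-≢ (sp m)) (card-Choices sp m k)) (chosen k))
  where
  chosen : ∀ k → HasCard (λ ((q , c) : Choices (suc m)) → q ≡ sp m × suc (specials sp c) ≡ k) (x· (rising m) k)
  chosen zero    = HasCard-∅ λ { _ (_ , ()) }
  chosen (suc k) =
    HasCard-cong (λ _ → mk⇔ (λ (q≡ , eq) → q≡ , cong suc eq) (λ (q≡ , eq) → q≡ , ℕₚ.suc-injective eq))
      (subst (HasCard _) (ℕₚ.*-identityˡ _)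
        (HasCard-× (HasCard-singleton (sp m) refl (λ _ → id)) (card-Choices sp m k)))
  split : ∀ q c → ((q ≢ sp m × specials sp c ≡ k) ⊎ (q ≡ sp m × suc (specials sp c) ≡ k))
                  ⇔ (specials sp (q , c) ≡ k)
  split q c with q Fin.≟ sp m
  ... | yes q≡ = mk⇔ (λ { (inj₁ (q≢ , _)) → contradiction q≡ q≢ ; (inj₂ (_ , eq)) → eq }) (λ eq → inj₂ (q≡ , eq))
  ... | no  q≢ = mk⇔ (λ { (inj₁ (_ , eq)) → eq ; (inj₂ (q≡ , _)) → contradiction q≡ q≢ }) (λ eq → inj₁ (q≢ , eq))

lookup-ext : {v w : Vec A n} → (∀ i → lookup v i ≡ lookup w i) → v ≡ w
lookup-ext {v = v} {w} eq =
  trans (sym (Vecₚ.tabulate∘lookup v)) (trans (Vecₚ.tabulate-cong eq) (Vecₚ.tabulate∘lookup w))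

parents : Choices m → Vec (Fin (suc m)) (suc m)
parents {zero}  _       = zero ∷ []
parents {suc m} (q , c) = suc q ∷ Vec.map suc (parents c)

parents-injective : (c d : Choices m) → parents c ≡ parents d → c ≡ d
parents-injective {zero}  _       _       _  = refl
parents-injective {suc m} (q , c) (r , d) eq =
  cong₂ _,_ (Finₚ.suc-injective (Vecₚ.∷-injectiveˡ eq))
    (parents-injective c d (lookup-ext λ i → Finₚ.suc-injective (begin
      suc (lookup (parents c) i)           ≡⟨ Vecₚ.lookup-map i suc (parents c) ⟨
      lookup (Vec.map suc (parents c)) i   ≡⟨ cong (λ v → lookup v i) (Vecₚ.∷-injectiveʳ eq) ⟩
      lookup (Vec.map suc (parents d)) i   ≡⟨ Vecₚ.lookup-map i suc (parents d) ⟩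
      suc (lookup (parents d) i)           ∎)))
  where open ≡-Reasoning

lookup-parents-suc : (q : Fin (suc m)) (c : Choices m) (i : Fin (suc m)) →
                     lookup (parents (q , c)) (suc i) ≡ suc (lookup (parents c) i)
lookup-parents-suc q c i = Vecₚ.lookup-map i suc (parents c)

-- The conditions on the parent vector of a decreasing tree that can be checked vertex by vertex;
-- that the root is reached is recovered in `parents-reach`.
Climbing : Vec (Fin (suc m)) (suc m) → Set
Climbing {m} P = lookup P (fromℕ m) ≡ fromℕ m × (∀ c → c ≢ fromℕ m → c Fin.< lookup P c)

parents-Climbing : (c : Choices m) → Climbing (parents c)
parents-Climbing {zero}  _       = refl , λ { zero c≢ → contradiction refl c≢ }
parents-Climbing {suc m} (q , c) with parents-Climbing c
... | fix , up =
    trans (lookup-parents-suc q c (fromℕ m)) (cong suc fix)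
  , λ { zero    _    → s≤s z≤n
      ; (suc i) i≢ → subst (suc i Fin.<_) (sym (lookup-parents-suc q c i)) (s≤s (up i (i≢ ∘ cong suc))) }

-- The value at `zero` is a default: past its first position a climbing vector has no entry `zero`.
Fin-pred : Fin (suc (suc m)) → Fin (suc m)
Fin-pred zero    = zero
Fin-pred (suc i) = i

suc-Fin-pred : {i j : Fin (suc (suc m))} → i Fin.< j → suc (Fin-pred j) ≡ j
suc-Fin-pred {j = suc j} _ = refl

Climbing-parents : (P : Vec (Fin (suc m)) (suc m)) → Climbing P → ∃ λ (c : Choices m) → parents c ≡ P
Climbing-parents {zero}  (zero ∷ []) _          = tt , refl
Climbing-parents {suc m} (zero ∷ P)  (fix , up) = contradiction (up zero (λ ())) λ ()
Climbing-parents {suc m} (suc q ∷ P) (fix , up) =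
  let c , eq = Climbing-parents P′ (fix′ , up′) in
  (q , c) , cong (suc q ∷_) (trans (cong (Vec.map suc) eq) (lookup-ext sucP′))
  where
  P′ = Vec.map Fin-pred P
  lookupP′ : ∀ i → lookup P′ i ≡ Fin-pred (lookup P i)
  lookupP′ i = Vecₚ.lookup-map i Fin-pred P
  suc-lookupP′ : ∀ i → suc (lookup P′ i) ≡ lookup P i
  suc-lookupP′ i with i Fin.≟ fromℕ m
  ... | yes refl rewrite lookupP′ (fromℕ m) | fix = refl
  ... | no  i≢ = trans (cong suc (lookupP′ i)) (suc-Fin-pred (up (suc i) (i≢ ∘ Finₚ.suc-injective)))
  sucP′ : ∀ i → lookup (Vec.map suc P′) i ≡ lookup P i
  sucP′ i = trans (Vecₚ.lookup-map i suc P′) (suc-lookupP′ i)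
  fix′ : lookup P′ (fromℕ m) ≡ fromℕ m
  fix′ = Finₚ.suc-injective (trans (suc-lookupP′ (fromℕ m)) fix)
  up′ : ∀ i → i ≢ fromℕ m → i Fin.< lookup P′ i
  up′ i i≢ = ℕₚ.≤-pred (subst (suc i Fin.<_) (sym (suc-lookupP′ i)) (up (suc i) (i≢ ∘ Finₚ.suc-injective)))

iter-conj : {f : A → A} {g : B → B} (h : A → B) → (∀ x → g (h x) ≡ h (f x)) →
            ∀ t x → iter g t (h x) ≡ h (iter f t x)
iter-conj         h comm zero    x = refl
iter-conj {g = g} h comm (suc t) x = trans (cong g (iter-conj h comm t x)) (comm _)

parents-reach : (c : Choices m) → ∀ v → ∃ λ t → iter (lookup (parents c)) t v ≡ fromℕ m
parents-reach {zero}  _       zero    = 0 , refl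
parents-reach {suc m} (q , c) zero    =
  let t , eq = parents-reach c q; f = lookup (parents (q , c)) in
  -- `iter` puts the last step outermost, so the first step, from `zero` to `suc q`, has to be
  -- commuted past the other `t` steps.
  suc t , trans (sym (iter-conj {f = f} {g = f} f (λ _ → refl) t zero))
                (trans (iter-conj {g = f} suc (lookup-parents-suc q c) t q) (cong suc eq))
parents-reach {suc m} (q , c) (suc v) =
  let t , eq = parents-reach c v in
  t , trans (iter-conj {g = lookup (parents (q , c))} suc (lookup-parents-suc q c) t v) (cong suc eq)

decTree : Choices m → RTreeData (suc m)
decTree c = fromℕ _ , parents c

decTree-IsDecreasing : (c : Choices m) → IsDecreasing (decTree c)
decTree-IsDecreasing c =
  (proj₁ (parents-Climbing c) , parents-reach c) ,
  λ { _ i (i≢ , refl) → proj₂ (parents-Climbing c) i i≢ }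

IsDecreasing-decTree : (T : RTreeData (suc m)) → IsDecreasing T → ∃ λ (c : Choices m) → decTree c ≡ T
IsDecreasing-decTree {m} (r , P) ((fix , _) , down) with fromℕ m Fin.≟ r
... | yes refl = let c , eq = Climbing-parents P (fix , λ i i≢ → down _ i (i≢ , refl)) in
                 c , cong (r ,_) eq
-- The root must be the largest vertex, which otherwise would have a larger parent.
... | no  last≢r = contradiction (down _ (fromℕ m) (last≢r , refl))
                                 (ℕₚ.≤⇒≯ (Finₚ.≤fromℕ (lookup P (fromℕ m))))

card-decTrees : (sp : ∀ m → Fin (suc m)) (Marked : RTreeData (suc m) → Fin (suc m) → Set) →
                (∀ c → HasCard (Marked (decTree c)) (specials sp c)) →
                HasCard (λ T → IsDecreasing T × HasCard (Marked T) k) (rising m k)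
card-decTrees {m} {k} sp Marked cardMarked =
  HasCard-bij decTree
    (λ { c refl → decTree-IsDecreasing c , cardMarked c })
    (λ {c} {d} _ _ eq → parents-injective c d (cong proj₂ eq))
    surj
    (card-Choices sp m k)
  where
  surj : ∀ T → IsDecreasing T × HasCard (Marked T) k → ∃ λ c → specials sp c ≡ k × decTree c ≡ T
  surj T (dec , card) with IsDecreasing-decTree T dec
  ... | c , refl = c , HasCard-unique (cardMarked c) card , refl

HasCard-Fin-suc : {P : Fin (suc n) → Set} {Q : Fin n → Set} (d : Dec A) →
                  A ⇔ P zero → (∀ i → Q i ⇔ P (suc i)) → HasCard Q k → HasCard P (bump d k)
HasCard-Fin-suc {A = A} {P = P} {Q} d zero⇔ suc⇔ card = go d
  where
  sucs : HasCard (λ j → ∃ λ i → j ≡ suc i × Q i) _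
  sucs = HasCard-bij suc (λ i Qi → i , refl , Qi) (λ _ _ → Finₚ.suc-injective)
           (λ { _ (i , refl , Qi) → i , Qi , refl }) card
  go : (d : Dec A) → HasCard P (bump d _)
  go (yes a) = HasCard-cong
    (λ { zero    → mk⇔ (λ { (inj₁ _) → to zero⇔ a ; (inj₂ (_ , () , _)) }) (λ _ → inj₁ refl)
       ; (suc i) → mk⇔ (λ { (inj₂ (_ , refl , Qi)) → to (suc⇔ i) Qi }) (λ Pi → inj₂ (i , refl , from (suc⇔ i) Pi)) })
    (HasCard-⊎ (λ { _ refl (_ , () , _) }) (HasCard-singleton zero refl (λ _ → id)) sucs)
  go (no ¬a) = HasCard-cong
    (λ { zero    → mk⇔ (λ { (_ , () , _) }) (λ Pz → contradiction (from zero⇔ Pz) ¬a)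
       ; (suc i) → mk⇔ (λ { (_ , refl , Qi) → to (suc⇔ i) Qi }) (λ Pi → i , refl , from (suc⇔ i) Pi) })
    sucs

card-rootChildren : (c : Choices m) →
  HasCard (λ i → i ≢ fromℕ m × lookup (parents c) i ≡ fromℕ m) (specials fromℕ c)
card-rootChildren {zero}  _       = HasCard-∅ λ { zero (i≢ , _) → i≢ refl }
card-rootChildren {suc m} (q , c) =
  HasCard-Fin-suc (q Fin.≟ fromℕ m)
    (mk⇔ (λ { refl → (λ ()) , refl }) (Finₚ.suc-injective ∘ proj₂))
    (λ i → mk⇔ (λ (i≢ , eq) → i≢ ∘ Finₚ.suc-injective , trans (lookup-parents-suc q c i) (cong suc eq))
               (λ (i≢ , eq) → i≢ ∘ cong suc , Finₚ.suc-injective (trans (sym (lookup-parents-suc q c i)) eq)))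
    (card-rootChildren c)

card-descentEdges : (c : Choices m) →
  HasCard (λ i → i ≢ fromℕ m × toℕ (lookup (parents c) i) ≡ suc (toℕ i)) (specials (λ _ → zero) c)
card-descentEdges {zero}  _       = HasCard-∅ λ { zero (i≢ , _) → i≢ refl }
card-descentEdges {suc m} (q , c) =
  HasCard-Fin-suc (q Fin.≟ zero)
    (mk⇔ (λ { refl → (λ ()) , refl }) (Finₚ.toℕ-injective ∘ ℕₚ.suc-injective ∘ proj₂))
    (λ i → mk⇔
      (λ (i≢ , eq) → i≢ ∘ Finₚ.suc-injective , trans (cong toℕ (lookup-parents-suc q c i)) (cong suc eq))
      (λ (i≢ , eq) → i≢ ∘ cong suc ,
                     ℕₚ.suc-injective (trans (sym (cong toℕ (lookup-parents-suc q c i))) eq)))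
    (card-descentEdges c)

card-DecRootDeg : ∀ m k → HasCard (DecRootDeg (suc m) k) (rising m k)
card-DecRootDeg m k = card-decTrees fromℕ (λ T → ChildrenOfLabel T (suc m)) λ c →
  HasCard-cong
    (λ i → mk⇔ (λ (i≢ , eq) → fromℕ m , cong suc (Finₚ.toℕ-fromℕ m) , i≢ , eq)
               (λ (v , lab , i≢ , eq) → i≢ , trans eq (Finₚ.toℕ-injective
                  (trans (ℕₚ.suc-injective lab) (sym (Finₚ.toℕ-fromℕ m))))))
    (card-rootChildren c)

card-DecAdjEdges : ∀ m k → HasCard (DecAdjEdges {suc m} k) (rising m k)
card-DecAdjEdges m k = card-decTrees (λ _ → zero) IsDescentEdgeChild λ c →
  HasCard-cong
    (λ i → mk⇔ (λ (i≢ , eq) → _ , (i≢ , refl) , eq) (λ { (_ , (i≢ , refl) , eq) → i≢ , eq }))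
    (card-descentEdges c)

-- Reversal of the labels

oppositeTree : RTreeData n → RTreeData n
oppositeTree (r , P) = opposite r , tabulate (λ i → opposite (lookup P (opposite i)))

lookup-oppositeTree : (T : RTreeData n) → ∀ i →
  lookup (proj₂ (oppositeTree T)) i ≡ opposite (lookup (proj₂ T) (opposite i))
lookup-oppositeTree T i = Vecₚ.lookup∘tabulate _ i

oppositeTree-involutive : (T : RTreeData n) → oppositeTree (oppositeTree T) ≡ T
oppositeTree-involutive T@(r , P) = cong₂ _,_ (Finₚ.opposite-involutive r) (lookup-ext λ i → begin
  lookup (proj₂ (oppositeTree (oppositeTree T))) i
    ≡⟨ lookup-oppositeTree (oppositeTree T) i ⟩
  opposite (lookup (proj₂ (oppositeTree T)) (opposite i))
    ≡⟨ cong opposite (lookup-oppositeTree T (opposite i)) ⟩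
  opposite (opposite (lookup P (opposite (opposite i))))
    ≡⟨ Finₚ.opposite-involutive _ ⟩
  lookup P (opposite (opposite i))
    ≡⟨ cong (lookup P) (Finₚ.opposite-involutive i) ⟩
  lookup P i
    ∎)
  where open ≡-Reasoning

opposite-injective : {i j : Fin n} → opposite i ≡ opposite j → i ≡ j
opposite-injective {i = i} {j} eq =
  trans (sym (Finₚ.opposite-involutive i)) (trans (cong opposite eq) (Finₚ.opposite-involutive j))

opposite-< : {i j : Fin n} → i Fin.< j → opposite j Fin.< opposite i
opposite-< {i = i} {j} i<j =
  subst₂ _<_ (sym (Finₚ.opposite-prop j)) (sym (Finₚ.opposite-prop i))
         (ℕₚ.∸-monoʳ-< (s≤s i<j) (Finₚ.toℕ<n j))

oppositeTree-IsRootedTree : (T : RTreeData n) → IsRootedTree T → IsRootedTree (oppositeTree T)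
oppositeTree-IsRootedTree T@(r , P) (fix , reach) =
    trans (conj r) (cong opposite fix)
  , λ v → let t , eq = reach (opposite v) in
          t , trans (cong (iter _ t) (sym (Finₚ.opposite-involutive v)))
                    (trans (iter-conj opposite conj t (opposite v)) (cong opposite eq))
  where
  conj : ∀ v → lookup (proj₂ (oppositeTree T)) (opposite v) ≡ opposite (lookup P v)
  conj v = trans (lookup-oppositeTree T (opposite v))
                 (cong (opposite ∘ lookup P) (Finₚ.opposite-involutive v))

oppositeTree-IsChild : (T : RTreeData n) → ∀ {v c} → IsChild T v c →
                       IsChild (oppositeTree T) (opposite v) (opposite c)
oppositeTree-IsChild T@(r , P) {c = c} (c≢r , refl) =
    c≢r ∘ opposite-injective
  , trans (lookup-oppositeTree T (opposite c)) (cong (opposite ∘ lookup P) (Finₚ.opposite-involutive c))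

oppositeTree-IsChild⁻ : (T : RTreeData n) → ∀ {v c} → IsChild (oppositeTree T) v c →
                        IsChild T (opposite v) (opposite c)
oppositeTree-IsChild⁻ T {v} {c} ch =
  subst (λ T → IsChild T (opposite v) (opposite c)) (oppositeTree-involutive T)
        (oppositeTree-IsChild (oppositeTree T) ch)

card-oppositeChildren : (T : RTreeData n) (P Q : Fin n → Set) →
  (∀ v → P v → Q (opposite v)) → (∀ v → Q v → P (opposite v)) →
  HasCard (λ c → Σ _ λ v → P v × IsChild T v c) k →
  HasCard (λ c → Σ _ λ v → Q v × IsChild (oppositeTree T) v c) k
card-oppositeChildren T P Q P⇒Q Q⇒P =
  HasCard-bij opposite
    (λ c (v , Pv , ch) → opposite v , P⇒Q v Pv , oppositeTree-IsChild T ch)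
    (λ _ _ → opposite-injective)
    (λ c (v , Qv , ch) → opposite c , (opposite v , Q⇒P v Qv , oppositeTree-IsChild⁻ T ch) ,
                         Finₚ.opposite-involutive c)

opposite-label-first : ∀ {m} (v : Fin (suc m)) → suc (toℕ v) ≡ suc m → suc (toℕ (opposite v)) ≡ 1
opposite-label-first {m} v eq = cong suc (trans (Finₚ.opposite-prop v) (trans (cong (suc m ∸_) eq) (ℕₚ.n∸n≡0 m)))

opposite-label-last : ∀ {m} (v : Fin (suc m)) → suc (toℕ v) ≡ 1 → suc (toℕ (opposite v)) ≡ suc m
opposite-label-last {m} v eq = cong suc (trans (Finₚ.opposite-prop v) (cong (suc m ∸_) eq))

card-IncRootDeg : ∀ m k → HasCard (IncRootDeg {suc m} k) (rising m k)
card-IncRootDeg m k =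
  HasCard-bij oppositeTree
    (λ T ((rooted , down) , card) →
        (oppositeTree-IsRootedTree T rooted ,
         λ v c ch → subst₂ Fin._<_ (Finₚ.opposite-involutive v) (Finₚ.opposite-involutive c)
                      (opposite-< (down _ _ (oppositeTree-IsChild⁻ T ch)))) ,
        card-oppositeChildren T _ _ opposite-label-first opposite-label-last card)
    (λ {T} {U} _ _ eq → trans (sym (oppositeTree-involutive T))
                          (trans (cong oppositeTree eq) (oppositeTree-involutive U)))
    (λ T ((rooted , up) , card) → oppositeTree T ,
        ((oppositeTree-IsRootedTree T rooted ,
          λ v c ch → subst₂ Fin._<_ (Finₚ.opposite-involutive c) (Finₚ.opposite-involutive v)
                       (opposite-< (up _ _ (oppositeTree-IsChild⁻ T ch)))) ,
         card-oppositeChildren T _ _ opposite-label-last opposite-label-first card) ,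
        oppositeTree-involutive T)
    (card-DecRootDeg m k)

-- Deletion and contraction

-- These are the local rules of the Tutte polynomial at y = 0: `unless` kills a loop, `weigh` gives
-- a coloop the factor x, and `when` tests whether the final choice spans. The decision is an
-- argument, so that equivalent decisions about different closures can replace each other.
when unless weigh : Dec A → Poly → Poly
when (yes _) p = p
when (no  _) p = λ _ → 0

unless (yes _) p = λ _ → 0
unless (no  _) p = p

weigh (yes _) p = p
weigh (no  _) p = x· p

when-cong : (d : Dec A) (d′ : Dec B) → (A → B) → (B → A) → ∀ p → when d p ≗ when d′ p
when-cong (yes _) (yes _) _ _ p k = refl
when-cong (yes a) (no ¬b) f _ p k = contradiction (f a) ¬b
when-cong (no ¬a) (yes b) _ g p k = contradiction (g b) ¬a
when-cong (no _)  (no _)  _ _ p k = refl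

unless-cong : (d : Dec A) (d′ : Dec B) → (A → B) → (B → A) →
              ∀ {p q} → p ≗ q → unless d p ≗ unless d′ q
unless-cong (yes _) (yes _) _ _ p≗q k = refl
unless-cong (yes a) (no ¬b) f _ p≗q k = contradiction (f a) ¬b
unless-cong (no ¬a) (yes b) _ g p≗q k = contradiction (g b) ¬a
unless-cong (no _)  (no _)  _ _ p≗q k = p≗q k

weigh-cong : (d : Dec A) (d′ : Dec B) → (A → B) → (B → A) →
             ∀ {p q} → p ≗ q → weigh d p ≗ weigh d′ q
weigh-cong (yes _) (yes _) _ _ p≗q = p≗q
weigh-cong (yes a) (no ¬b) f _ p≗q = contradiction (f a) ¬b
weigh-cong (no ¬a) (yes b) _ g p≗q = contradiction (g b) ¬a
weigh-cong (no _)  (no _)  _ _ p≗q = x·-cong p≗q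

weigh-zero : (d : Dec A) → ∀ {p} → (∀ k → p k ≡ 0) → ∀ k → weigh d p k ≡ 0
weigh-zero (yes _) p≡0 k       = p≡0 k
weigh-zero (no _)  p≡0 zero    = refl
weigh-zero (no _)  p≡0 (suc k) = p≡0 k

weigh-+ : (d : Dec A) → ∀ p q k → weigh d (λ k → p k + q k) k ≡ weigh d p k + weigh d q k
weigh-+ (yes _) p q k       = refl
weigh-+ (no _)  p q zero    = refl
weigh-+ (no _)  p q (suc k) = refl

weigh-comm : (d : Dec A) (d′ : Dec B) → ∀ p → weigh d (weigh d′ p) ≗ weigh d′ (weigh d p)
weigh-comm (yes _) _       p k = refl
weigh-comm (no _)  (yes _) p k = refl
weigh-comm (no _)  (no _)  p k = refl

⊆-skip : (S : List A) {L : List A} {e : A} → S ++ L ⊆ S ++ e ∷ L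
⊆-skip S = ⊆ₚ.++⁺ʳ S there

⊆-move : (S : List A) {L : List A} {e : A} → e ∷ S ++ L ⊆ S ++ e ∷ L
⊆-move S (here refl) = ∈-++⁺ʳ S (here refl)
⊆-move S (there s∈)  = ⊆-skip S s∈

⊆-move⁻ : (S : List A) {L : List A} {e : A} → S ++ e ∷ L ⊆ e ∷ S ++ L
⊆-move⁻ S s∈ with ∈-++⁻ S s∈
... | inj₁ s∈S         = there (∈-++⁺ˡ s∈S)
... | inj₂ (here refl) = here refl
... | inj₂ (there s∈L) = there (∈-++⁺ʳ S s∈L)

∷-comm-⊆ : {S : List A} {e f : A} → e ∷ f ∷ S ⊆ f ∷ e ∷ S
∷-comm-⊆ (here refl)         = there (here refl)
∷-comm-⊆ (there (here refl)) = here refl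
∷-comm-⊆ (there (there s∈))  = there (there s∈)

-- A matroid given by its closure operator. `cl-trans` combines monotonicity with idempotence, and
-- `cl-exch` is the Mac Lane-Steinitz exchange property. Lists stand for sets: `cl-∈` and `cl-trans`
-- make order and repetition invisible to `Cl`.
module Matroid {E : Set}
  (Cl         : List E → E → Set)
  (Cl?        : ∀ S e → Dec (Cl S e))
  (cl-∈       : ∀ {S e} → e ∈ S → Cl S e)
  (cl-trans   : ∀ {S S′ e} → (∀ {s} → s ∈ S → Cl S′ s) → Cl S e → Cl S′ e)
  (cl-exch    : ∀ {S e f} → Cl (f ∷ S) e → ¬ Cl S e → Cl (e ∷ S) f)
  (Spanning?  : ∀ S → Dec (∀ e → Cl S e))
  where

  infix 4 _≼_
  _≼_ : List E → List E → Set
  S ≼ S′ = ∀ {s} → s ∈ S → Cl S′ s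

  cl-mono : ∀ {S S′ e} → S ⊆ S′ → Cl S e → Cl S′ e
  cl-mono S⊆S′ = cl-trans (cl-∈ ∘ S⊆S′)

  ∷-≼ : ∀ {S S′ e} → Cl S′ e → S ≼ S′ → e ∷ S ≼ S′
  ∷-≼ e∈ S≼ (here refl) = e∈
  ∷-≼ e∈ S≼ (there s∈)  = S≼ s∈

  ∷⁺-≼ : ∀ {S S′} e → S ≼ S′ → e ∷ S ≼ e ∷ S′
  ∷⁺-≼ e S≼ = ∷-≼ (cl-∈ (here refl)) (cl-mono there ∘ S≼)

  ++⁺-≼ : ∀ {S S′} L → S ≼ S′ → S ++ L ≼ S′ ++ L
  ++⁺-≼ {S} {S′} L S≼ s∈ with ∈-++⁻ S s∈
  ... | inj₁ s∈S = cl-mono ∈-++⁺ˡ (S≼ s∈S)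
  ... | inj₂ s∈L = cl-∈ (∈-++⁺ʳ S′ s∈L)

  -- T S L is the Tutte polynomial T(x, 0) of the minor obtained by contracting S and restricting
  -- to S ∪ L, computed by deletion and contraction of the elements of L from left to right;
  -- it is 0 when S ∪ L does not span.
  T : List E → List E → Poly
  T S []      = when (Spanning? S) δ
  T S (f ∷ L) = unless (Cl? S f) λ k → T S L k + weigh (Cl? (S ++ L) f) (T (f ∷ S) L) k

  T-loop : ∀ {S f} L → Cl S f → ∀ k → T S (f ∷ L) k ≡ 0
  T-loop {S} {f} L f∈ k with Cl? S f
  ... | yes _  = refl
  ... | no  f∉ = contradiction f∈ f∉

  T-nonloop : ∀ {S f} L → ¬ Cl S f → ∀ k →
              T S (f ∷ L) k ≡ T S L k + weigh (Cl? (S ++ L) f) (T (f ∷ S) L) k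
  T-nonloop {S} {f} L f∉ k with Cl? S f
  ... | yes f∈ = contradiction f∈ f∉
  ... | no  _  = refl

  -- Every test made by `T` asks for membership in a closure, so only the closure of the contracted
  -- set matters.
  T-cong : ∀ {S S′} L → S ≼ S′ → S′ ≼ S → T S L ≗ T S′ L
  T-cong {S} {S′} [] S≼ S′≼ =
    when-cong (Spanning? S) (Spanning? S′) (cl-trans S≼ ∘_) (cl-trans S′≼ ∘_) δ
  T-cong {S} {S′} (f ∷ L) S≼ S′≼ =
    unless-cong (Cl? S f) (Cl? S′ f) (cl-trans S≼) (cl-trans S′≼) λ k →
      cong₂ _+_ (T-cong L S≼ S′≼ k)
        (weigh-cong (Cl? (S ++ L) f) (Cl? (S′ ++ L) f)
          (cl-trans (++⁺-≼ L S≼)) (cl-trans (++⁺-≼ L S′≼))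
          (T-cong L (∷⁺-≼ f S≼) (∷⁺-≼ f S′≼)) k)

  T-∷-comm : ∀ {S e f} L → T (e ∷ f ∷ S) L ≗ T (f ∷ e ∷ S) L
  T-∷-comm L = T-cong L (cl-∈ ∘ ∷-comm-⊆) (cl-∈ ∘ ∷-comm-⊆)

  -- The recursion for `T` adds the deletion term even when `f` is a coloop; that term vanishes
  -- because what is left does not span.
  T-nonspanning : ∀ {S} L → ¬ (∀ e → Cl (S ++ L) e) → ∀ k → T S L k ≡ 0
  T-nonspanning {S} [] ¬span k with Spanning? S
  ... | yes span = contradiction (λ e → cl-mono ∈-++⁺ˡ (span e)) ¬span
  ... | no  _    = refl
  T-nonspanning {S} (f ∷ L) ¬span k with Cl? S f
  ... | yes _ = refl
  ... | no  _ = cong₂ _+_ (T-nonspanning L (λ span → ¬span (cl-mono (⊆-skip S) ∘ span)) k)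
    (weigh-zero (Cl? (S ++ L) f) (T-nonspanning L (λ span → ¬span (cl-mono (⊆-move S) ∘ span))) k)

  -- A loop stays a loop while `S` grows, so it kills every branch once it is reached.
  T-hasLoop : ∀ {S g} L → g ∈ L → Cl S g → ∀ k → T S L k ≡ 0
  T-hasLoop (g ∷ L) (here refl) g∈cl k = T-loop L g∈cl k
  T-hasLoop {S} (f ∷ L) (there g∈) g∈cl k with Cl? S f
  ... | yes _ = refl
  ... | no  _ = cong₂ _+_ (T-hasLoop L g∈ g∈cl k)
    (weigh-zero (Cl? (S ++ L) f) (T-hasLoop L g∈ (cl-mono there g∈cl)) k)

  -- If `g` were spanned only with the help of `e`, exchange would put `e` into the closure of
  -- `g ∷ S`, hence of `S′`.
  cl-coloop : ∀ {S S′ e g} → S ⊆ S′ → g ∈ S′ → ¬ Cl S′ e → Cl (e ∷ S) g → Cl S g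
  cl-coloop {S} {g = g} S⊆ g∈ e∉ g∈cl with Cl? S g
  ... | yes g∈clS = g∈clS
  ... | no  g∉    = contradiction (cl-trans (∷-≼ (cl-∈ g∈) (cl-∈ ∘ S⊆)) (cl-exch g∈cl g∉)) e∉

  -- By `cl-coloop`, contracting an element outside the closure of `S ++ L` does not change which
  -- elements of `L` pass the loop and coloop tests. When `L` is exhausted, exchange trades `e` for
  -- `f` in a spanning set.
  T-coloops : ∀ {S e f} L → ¬ Cl (S ++ L) e → ¬ Cl (S ++ L) f → T (e ∷ S) L ≗ T (f ∷ S) L
  T-coloops {S} {e} {f} [] e∉ f∉ =
    when-cong (Spanning? (e ∷ S)) (Spanning? (f ∷ S)) (exchange-span f∉) (exchange-span e∉) δ
    where
    exchange-span : ∀ {e f} → ¬ Cl (S ++ []) f → (∀ g → Cl (e ∷ S) g) → ∀ g → Cl (f ∷ S) g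
    exchange-span f∉ span g =
      cl-trans (∷-≼ (cl-exch (span _) (f∉ ∘ cl-mono ∈-++⁺ˡ)) (cl-∈ ∘ there)) (span g)
  T-coloops {S} {e} {f} (g ∷ L) e∉ f∉ =
    unless-cong (Cl? (e ∷ S) g) (Cl? (f ∷ S) g) (loop e∉) (loop f∉) λ k →
      cong₂ _+_
        (T-coloops L (e∉ ∘ cl-mono (⊆-skip S)) (f∉ ∘ cl-mono (⊆-skip S)) k)
        (weigh-cong (Cl? (e ∷ S ++ L) g) (Cl? (f ∷ S ++ L) g) (coloop e∉) (coloop f∉)
          (λ k → trans (T-∷-comm L k) (trans
            (T-coloops L (e∉ ∘ cl-mono (⊆-move S)) (f∉ ∘ cl-mono (⊆-move S)) k)
            (T-∷-comm L k)))
          k)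
    where
    loop : ∀ {e f} → ¬ Cl (S ++ g ∷ L) e → Cl (e ∷ S) g → Cl (f ∷ S) g
    loop e∉ = cl-mono there ∘ cl-coloop ∈-++⁺ˡ (∈-++⁺ʳ S (here refl)) e∉
    coloop : ∀ {e f} → ¬ Cl (S ++ g ∷ L) e → Cl (e ∷ S ++ L) g → Cl (f ∷ S ++ L) g
    coloop e∉ = cl-mono there ∘ cl-coloop (⊆-skip S) (∈-++⁺ʳ S (here refl)) e∉

  module Swap {S : List E} {e f : E} (L : List E) (e∉ : ¬ Cl S e) (f∉ : ¬ Cl S f) where

    -- Contracting `e` turns `f` into a loop, so only the terms that delete `e` survive.
    expand-parallel : Cl (e ∷ S) f → ∀ k →
      T S (e ∷ f ∷ L) k ≡ T S L k + weigh (Cl? (S ++ L) f) (T (f ∷ S) L) k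
    expand-parallel f∈ k = begin
      T S (e ∷ f ∷ L) k
        ≡⟨ T-nonloop (f ∷ L) e∉ k ⟩
      T S (f ∷ L) k + weigh (Cl? (S ++ f ∷ L) e) (T (e ∷ S) (f ∷ L)) k
        ≡⟨ cong₂ _+_ (T-nonloop L f∉ k) (weigh-zero (Cl? (S ++ f ∷ L) e) (T-loop L f∈) k) ⟩
      T S L k + weigh (Cl? (S ++ L) f) (T (f ∷ S) L) k + 0
        ≡⟨ ℕₚ.+-identityʳ _ ⟩
      T S L k + weigh (Cl? (S ++ L) f) (T (f ∷ S) L) k
        ∎
      where open ≡-Reasoning

    expand : ¬ Cl (e ∷ S) f → ∀ k →
      T S (e ∷ f ∷ L) k ≡
        T S L k + weigh (Cl? (S ++ L) f) (T (f ∷ S) L) k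
        + (weigh (Cl? (S ++ f ∷ L) e) (T (e ∷ S) L) k
           + weigh (Cl? (S ++ f ∷ L) e) (weigh (Cl? (e ∷ S ++ L) f) (T (f ∷ e ∷ S) L)) k)
    expand f∉e k = begin
      T S (e ∷ f ∷ L) k
        ≡⟨ T-nonloop (f ∷ L) e∉ k ⟩
      T S (f ∷ L) k + weigh d (T (e ∷ S) (f ∷ L)) k
        ≡⟨ cong₂ _+_ (T-nonloop L f∉ k)
                     (weigh-cong d d id id (T-nonloop L f∉e) k) ⟩
      T S L k + weigh (Cl? (S ++ L) f) (T (f ∷ S) L) k
        + weigh d (λ k → T (e ∷ S) L k + weigh (Cl? (e ∷ S ++ L) f) (T (f ∷ e ∷ S) L) k) k
        ≡⟨ cong₂ _+_ refl (weigh-+ d (T (e ∷ S) L) _ k) ⟩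
      _ ∎
      where
      open ≡-Reasoning
      d = Cl? (S ++ f ∷ L) e

  -- Expanding both elements gives four terms. Those deleting both and those contracting both agree
  -- separately. The two terms contracting exactly one element must be compared as a sum: the weight
  -- of the earlier element is tested with the later one still present, so a factor x may pass from
  -- one term to the other.
  T-swap : ∀ {S e f} L → T S (e ∷ f ∷ L) ≗ T S (f ∷ e ∷ L)
  T-swap {S} {e} {f} L k = cases (Cl? S e) (Cl? S f)
    where
    open ≡-Reasoning
    te = T (e ∷ S) L
    tf = T (f ∷ S) L
    go : ¬ Cl S e → ¬ Cl S f → Dec (Cl (e ∷ S) f) → T S (e ∷ f ∷ L) k ≡ T S (f ∷ e ∷ L) k
    go e∉ f∉ (yes f∈) = begin
      T S (e ∷ f ∷ L) k
        ≡⟨ Swap.expand-parallel L e∉ f∉ f∈ k ⟩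
      T S L k + weigh (Cl? (S ++ L) f) tf k
        ≡⟨ cong₂ _+_ (refl {x = T S L k}) (weigh-cong (Cl? (S ++ L) f) (Cl? (S ++ L) e) (via e∈) (via f∈)
             (T-cong L (∷-≼ f∈ (cl-∈ ∘ there)) (∷-≼ e∈ (cl-∈ ∘ there))) k) ⟩
      T S L k + weigh (Cl? (S ++ L) e) te k
        ≡⟨ Swap.expand-parallel L f∉ e∉ e∈ k ⟨
      T S (f ∷ e ∷ L) k
        ∎
      where
      e∈ = cl-exch f∈ f∉
      via : ∀ {e f} → Cl (f ∷ S) e → Cl (S ++ L) f → Cl (S ++ L) e
      via e∈ f∈L = cl-trans (∷-≼ f∈L (cl-∈ ∘ ∈-++⁺ˡ)) e∈
    go e∉ f∉ (no f∉e) = begin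
      T S (e ∷ f ∷ L) k
        ≡⟨ Swap.expand L e∉ f∉ f∉e k ⟩
      T S L k + wf + (we′ + wef)
        ≡⟨ solve 4 (λ a b c d → a :+ b :+ (c :+ d) := a :+ (b :+ c) :+ d) refl (T S L k) wf we′ wef ⟩
      T S L k + (wf + we′) + wef
        ≡⟨ cong₂ (λ a b → T S L k + a + b) (middle (Cl? (S ++ L) e) (Cl? (S ++ L) f)) wef≡wfe ⟩
      T S L k + (we + wf′) + wfe
        ≡⟨ solve 4 (λ a b c d → a :+ (b :+ c) :+ d := a :+ b :+ (c :+ d)) refl (T S L k) we wf′ wfe ⟩
      T S L k + we + (wf′ + wfe)
        ≡⟨ Swap.expand L f∉ e∉ e∉f k ⟨
      T S (f ∷ e ∷ L) k
        ∎
      where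
      open +-*-Solver
      e∉f : ¬ Cl (f ∷ S) e
      e∉f e∈ = f∉e (cl-exch e∈ e∉)
      de  = Cl? (S ++ L) e
      df  = Cl? (S ++ L) f
      de′ = Cl? (S ++ f ∷ L) e
      df′ = Cl? (S ++ e ∷ L) f
      we  = weigh de te k
      wf  = weigh df tf k
      we′ = weigh de′ te k
      wf′ = weigh df′ tf k
      wef = weigh de′ (weigh (Cl? (e ∷ S ++ L) f) (T (f ∷ e ∷ S) L)) k
      wfe = weigh df′ (weigh (Cl? (f ∷ S ++ L) e) (T (e ∷ f ∷ S) L)) k
      wef≡wfe : wef ≡ wfe
      wef≡wfe = trans (weigh-comm de′ (Cl? (e ∷ S ++ L) f) _ k)
        (weigh-cong (Cl? (e ∷ S ++ L) f) df′ (cl-mono (⊆-move S)) (cl-mono (⊆-move⁻ S))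
          (weigh-cong de′ (Cl? (f ∷ S ++ L) e) (cl-mono (⊆-move⁻ S)) (cl-mono (⊆-move S)) (T-∷-comm L)) k)
      middle : Dec (Cl (S ++ L) e) → Dec (Cl (S ++ L) f) → wf + we′ ≡ we + wf′
      -- An `e` already spanned by `S ++ L` can be added to `L` without changing closures, so each
      -- term keeps its weight.
      middle (yes e∈) _ = trans (ℕₚ.+-comm wf we′) (cong₂ _+_
        (weigh-cong de′ de (λ _ → e∈) (cl-mono (⊆-skip S)) (λ _ → refl) k)
        (weigh-cong df df′ (cl-mono (⊆-skip S)) (cl-trans (∷-≼ e∈ cl-∈ ∘ ⊆-move⁻ S)) (λ _ → refl) k))
      middle (no _) (yes f∈) = trans (ℕₚ.+-comm wf we′) (cong₂ _+_
        (weigh-cong de′ de (cl-trans (∷-≼ f∈ cl-∈ ∘ ⊆-move⁻ S)) (cl-mono (⊆-skip S)) (λ _ → refl) k)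
        (weigh-cong df df′ (cl-mono (⊆-skip S)) (λ _ → f∈) (λ _ → refl) k))
      -- e and f are coloops of the rest, so contracting either one leaves the same polynomial.
      middle (no e∉L) (no f∉L) = cong₂ _+_
        (weigh-cong df de (λ f∈ → contradiction f∈ f∉L) (λ e∈ → contradiction e∈ e∉L) (sym ∘ te≗tf) k)
        (weigh-cong de′ df′
          (λ e∈ → cl-mono (⊆-move S) (cl-exch (cl-mono (⊆-move⁻ S) e∈) e∉L))
          (λ f∈ → cl-mono (⊆-move S) (cl-exch (cl-mono (⊆-move⁻ S) f∈) f∉L))
          te≗tf k)
        where
        te≗tf : te ≗ tf
        te≗tf = T-coloops L e∉L f∉L

    cases : Dec (Cl S e) → Dec (Cl S f) → T S (e ∷ f ∷ L) k ≡ T S (f ∷ e ∷ L) k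
    cases (yes e∈) _        = trans (T-loop (f ∷ L) e∈ k) (sym (T-hasLoop (f ∷ e ∷ L) (there (here refl)) e∈ k))
    cases (no _)   (yes f∈) = trans (T-hasLoop (e ∷ f ∷ L) (there (here refl)) f∈ k) (sym (T-loop (e ∷ L) f∈ k))
    cases (no e∉)  (no f∉)  = go e∉ f∉ (Cl? (e ∷ S) f)

  T-prep : ∀ f {L L′} → L ⊆ L′ → L′ ⊆ L → (∀ S → T S L ≗ T S L′) → ∀ S → T S (f ∷ L) ≗ T S (f ∷ L′)
  T-prep f {L} {L′} L⊆ L′⊆ eq S = unless-cong (Cl? S f) (Cl? S f) id id λ k →
    cong₂ _+_ (eq S k) (weigh-cong (Cl? (S ++ L) f) (Cl? (S ++ L′) f)
      (cl-mono (⊆ₚ.++⁺ʳ S L⊆)) (cl-mono (⊆ₚ.++⁺ʳ S L′⊆)) (eq (f ∷ S)) k)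

  T-↭ : ∀ {L L′} → L ↭ L′ → ∀ S → T S L ≗ T S L′
  T-↭ Perm.refl          S k = refl
  T-↭ (Perm.prep f p)    S   = T-prep f (∈-resp-↭ p) (∈-resp-↭ (Perm.↭-sym p)) (T-↭ p) S
  T-↭ (Perm.swap {xs} {ys} e f p) S k =
    trans (T-swap xs k) (T-prep f (∈-resp-↭ (Perm.prep e p)) (∈-resp-↭ (Perm.↭-sym (Perm.prep e p)))
      (T-prep e (∈-resp-↭ p) (∈-resp-↭ (Perm.↭-sym p)) (T-↭ p)) S k)
  T-↭ (Perm.trans p q)   S k = trans (T-↭ p S k) (T-↭ q S k)

-- Walks and circles

private variable
  E E′ F : EdgePred n
  u v w : Fin n
  e f : Edge n

edge-ext : lo e ≡ lo f → hi e ≡ hi f → e ≡ f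
edge-ext {e = mkEdge a b p} {mkEdge a b q} refl refl = cong (mkEdge a b) (Finₚ.<-irrelevant p q)

edge-reversed : (e f : Edge n) → lo e ≡ hi f → hi e ≡ lo f → ⊥
edge-reversed (mkEdge _ _ p) (mkEdge _ _ q) refl refl = ℕₚ.<-asym p q

lo≢hi : (e : Edge n) → lo e ≢ hi e
lo≢hi e eq = ℕₚ.<-irrefl (cong toℕ eq) (lo<hi e)

_Joins_,_ : Edge n → Fin n → Fin n → Set
e Joins u , v = (lo e ≡ u × hi e ≡ v) ⊎ (lo e ≡ v × hi e ≡ u)

edgeBetween : u ≢ v → ∃ λ (e : Edge n) → e Joins u , v
edgeBetween {u = u} {v} u≢v with Finₚ.<-cmp u v
... | tri< u<v _ _ = mkEdge u v u<v , inj₁ (refl , refl)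
... | tri≈ _ u≡v _ = contradiction u≡v u≢v
... | tri> _ _ v<u = mkEdge v u v<u , inj₂ (refl , refl)

Joins-unique : e Joins u , v → f Joins u , v → e ≡ f
Joins-unique (inj₁ (refl , refl)) (inj₁ (p , q)) = edge-ext (sym p) (sym q)
Joins-unique {e = e} {f = f} (inj₁ (refl , refl)) (inj₂ (p , q)) = ⊥-elim (edge-reversed f e p q)
Joins-unique {e = e} {f = f} (inj₂ (refl , refl)) (inj₁ (p , q)) = ⊥-elim (edge-reversed f e p q)
Joins-unique (inj₂ (refl , refl)) (inj₂ (p , q)) = edge-ext (sym p) (sym q)

Joins-sym : e Joins u , v → e Joins v , u
Joins-sym (inj₁ p) = inj₂ p
Joins-sym (inj₂ p) = inj₁ p

walk-trans : Walk E u v → Walk E v w → Walk E u w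
walk-trans here       q = q
walk-trans (step a p) q = step a (walk-trans p q)

walk-edge : E e → e Joins u , v → Walk E u v
walk-edge {e = e} Ee j = step (e , Ee , j) here

walk-sym : Walk E u v → Walk E v u
walk-sym here                   = here
walk-sym (step (e , Ee , j) p) = walk-trans (walk-sym p) (walk-edge Ee (Joins-sym {e = e} j))

Joined : EdgePred n → Edge n → Set
Joined E e = Walk E (lo e) (hi e)

joined-edge : E e → Joined E e
joined-edge Ee = walk-edge Ee (inj₁ (refl , refl))

Joined⇒walk : Joined E e → e Joins u , v → Walk E u v
Joined⇒walk p (inj₁ (refl , refl)) = p
Joined⇒walk p (inj₂ (refl , refl)) = walk-sym p

walk-bind : (∀ e → E e → Joined F e) → Walk E u v → Walk F u v
walk-bind E⇒F here                  = here
walk-bind E⇒F (step (e , Ee , j) p) = walk-trans (Joined⇒walk {e = e} (E⇒F e Ee) j) (walk-bind E⇒F p)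

walk-map : (∀ e → E e → F e) → Walk E u v → Walk F u v
walk-map E⇒F = walk-bind λ e Ee → joined-edge (E⇒F e Ee)

allJoined⇒Connected : (∀ e → Joined E e) → Connected E
allJoined⇒Connected joined u v with u Fin.≟ v
... | yes refl = here
... | no  u≢v  = let e , j = edgeBetween u≢v in Joined⇒walk {e = e} (joined e) j

-- Cut the walk at its first and last use of `f` and drop the stretch between: `f` is crossed at
-- most once. This yields both the decision procedure `walk?` and the exchange property.
walk-split : (∀ g → E′ g → E g ⊎ g ≡ f) → Walk E′ u v →
             Walk E u v ⊎ (Walk E u (lo f) × Walk E (hi f) v) ⊎ (Walk E u (hi f) × Walk E (lo f) v)
walk-split sp here = inj₁ here
walk-split sp (step (g , E′g , j) p) with sp g E′g | j | walk-split sp p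
... | inj₁ Eg   | j | inj₁ q              = inj₁ (step (g , Eg , j) q)
... | inj₁ Eg   | j | inj₂ (inj₁ (q , r)) = inj₂ (inj₁ (step (g , Eg , j) q , r))
... | inj₁ Eg   | j | inj₂ (inj₂ (q , r)) = inj₂ (inj₂ (step (g , Eg , j) q , r))
... | inj₂ refl | inj₁ (refl , refl) | inj₁ q              = inj₂ (inj₁ (here , q))
... | inj₂ refl | inj₁ (refl , refl) | inj₂ (inj₁ (_ , r)) = inj₂ (inj₁ (here , r))
... | inj₂ refl | inj₁ (refl , refl) | inj₂ (inj₂ (_ , r)) = inj₁ r
... | inj₂ refl | inj₂ (refl , refl) | inj₁ q              = inj₂ (inj₂ (here , q))
... | inj₂ refl | inj₂ (refl , refl) | inj₂ (inj₁ (_ , r)) = inj₁ r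
... | inj₂ refl | inj₂ (refl , refl) | inj₂ (inj₂ (_ , r)) = inj₂ (inj₂ (here , r))

-- A walk between the ends of `e` that needs `f` closes up with `e` to a round trip through `f`;
-- going round the other way joins the ends of `f`. The general predicates let this serve both for
-- closures of lists and for spanning trees.
joined-exchange : (∀ g → E′ g → E g ⊎ g ≡ f) → (∀ g → E g → F g) → F e →
                  Joined E′ e → ¬ Joined E e → Joined F f
joined-exchange sp E⇒F Fe p ¬p with walk-split sp p
... | inj₁ q              = contradiction q ¬p
... | inj₂ (inj₁ (q , r)) = walk-trans (walk-sym (walk-map E⇒F q))
                              (walk-trans (joined-edge Fe) (walk-sym (walk-map E⇒F r)))
... | inj₂ (inj₂ (q , r)) = walk-trans (walk-map E⇒F r)
                              (walk-trans (walk-sym (joined-edge Fe)) (walk-map E⇒F q))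

-- The graphic matroid of the complete graph

Span : List (Edge n) → Edge n → Set
Span S = Joined (_∈ S)

∈-∷⁻ : ∀ (S : List (Edge n)) {f} g → g ∈ f ∷ S → g ∈ S ⊎ g ≡ f
∈-∷⁻ S g (here g≡f) = inj₂ g≡f
∈-∷⁻ S g (there g∈) = inj₁ g∈

walk? : (S : List (Edge n)) → ∀ u v → Dec (Walk (_∈ S) u v)
walk? []      u v = map′ (λ { refl → here }) (λ { here → refl ; (step (_ , () , _) _) }) (u Fin.≟ v)
walk? (f ∷ S) u v =
  map′ merge (walk-split (∈-∷⁻ S))
    (walk? S u v ⊎-dec ((walk? S u (lo f) ×-dec walk? S (hi f) v) ⊎-dec (walk? S u (hi f) ×-dec walk? S (lo f) v)))
  where
  weaken : ∀ {u v} → Walk (_∈ S) u v → Walk (_∈ f ∷ S) u v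
  weaken = walk-map (λ _ → there)
  f-step : Walk (_∈ f ∷ S) (lo f) (hi f)
  f-step = joined-edge (here refl)
  merge : _ → Walk (_∈ f ∷ S) u v
  merge (inj₁ p)              = weaken p
  merge (inj₂ (inj₁ (p , q))) = walk-trans (weaken p) (walk-trans f-step (weaken q))
  merge (inj₂ (inj₂ (p , q))) = walk-trans (weaken p) (walk-trans (walk-sym f-step) (weaken q))

spanning? : (S : List (Edge n)) → Dec (∀ e → Span S e)
spanning? S = map′ (λ conn e → conn (lo e) (hi e)) allJoined⇒Connected
                   (Finₚ.all? λ u → Finₚ.all? λ v → walk? S u v)

module Graphic {n : ℕ} = Matroid {Edge n} Span (λ S e → walk? S (lo e) (hi e)) joined-edge
  (λ S≼S′ → walk-bind (λ _ → S≼S′))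
  (λ {S} {e} {f} → joined-exchange (∈-∷⁻ S) (λ _ → there) (here refl))
  spanning?

-- The list omits the start `u`, so that closing the path gives the pairs
-- `zip (u ∷ vs) (vs ++ [ u ])`, to which `cycPairs (u ∷ vs)` unfolds.
data Path (E : EdgePred n) : Fin n → List (Fin n) → Fin n → Set where
  stop : Path E v [] v
  _◅_  : ∀ {vs} → Adj E u w → Path E w vs v → Path E u (w ∷ vs) v

suffixPath : ∀ {vs} → Path E w vs v → Unique (w ∷ vs) → u ∈ w ∷ vs →
             ∃ λ us → Path E u us v × Unique (u ∷ us)
suffixPath p       vs!       (here refl) = _ , p , vs!
suffixPath (_ ◅ p) (_ ∷ vs!) (there u∈)  = suffixPath p vs! u∈

loopErase : Walk E u v → ∃ λ vs → Path E u vs v × Unique (u ∷ vs)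
loopErase here = [] , stop , [] ∷ []
loopErase {u = u} (step {w = w} a p) with loopErase p
... | vs , q , vs! with DecMembership._∈?_ Fin._≟_ u (w ∷ vs)
...   | yes u∈ = suffixPath q vs! u∈
...   | no  u∉ = w ∷ vs , a ◅ q , Allₚ.¬Any⇒All¬ (w ∷ vs) u∉ ∷ vs!

path-pairs : ∀ {vs a b x} → Path E u vs v → (a , b) ∈ zip (u ∷ vs) (vs ++ [ x ]) →
             Adj E a b ⊎ (a ≡ v × b ≡ x)
path-pairs stop    (here refl) = inj₂ (refl , refl)
path-pairs (a ◅ p) (here refl) = inj₁ a
path-pairs (a ◅ p) (there ab∈) = path-pairs p ab∈

last-pair : ∀ {vs} x → Path E u vs v → (v , x) ∈ zip (u ∷ vs) (vs ++ [ x ])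
last-pair x stop    = here refl
last-pair x (_ ◅ p) = there (last-pair x p)

adj⇒edge : Adj E u v → e Joins u , v → E e
adj⇒edge {E = E} (f , Ef , j) j′ = subst E (Joins-unique j j′) Ef

-- Closing up a loop-erased walk between the ends of f by f itself yields a circle.
circleThrough : ¬ E f → Joined E f → ∃ λ vs → IsCircle vs × EdgeOfCircle vs f ×
                (∀ e → EdgeOfCircle vs e → e ≢ f → E e)
circleThrough {E = E} {f} ¬Ef p with loopErase p
... | vs , q , vs! =
    lo f ∷ vs , (vs! , long q (lo≢hi f) (λ a → ¬Ef (adj⇒edge a (inj₁ (refl , refl)))))
  , inj₂ (last-pair (lo f) q)
  , inE
  where
  -- A path with a single edge would be `f` itself, which is not in `E`; so the path has at least
  -- three vertices.
  long : ∀ {u v vs} → Path E u vs v → u ≢ v → ¬ Adj E u v → 3 ≤ length (u ∷ vs)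
  long stop          u≢v _   = contradiction refl u≢v
  long (a ◅ stop)    _   ¬a  = contradiction a ¬a
  long (_ ◅ (_ ◅ _)) _   _   = s≤s (s≤s (s≤s z≤n))
  inE : ∀ e → EdgeOfCircle (lo f ∷ vs) e → e ≢ f → E e
  inE e (inj₁ ab∈) e≢f with path-pairs q ab∈
  ... | inj₁ a          = adj⇒edge a (inj₁ (refl , refl))
  ... | inj₂ (eq , eq′) = ⊥-elim (edge-reversed e f eq eq′)
  inE e (inj₂ ab∈) e≢f with path-pairs q ab∈
  ... | inj₁ a          = adj⇒edge a (inj₂ (refl , refl))
  ... | inj₂ (eq , eq′) = contradiction (edge-ext eq′ eq) e≢f

-- Circles as detours around their edges

Unique-resp-↭ : {xs ys : List A} → xs ↭ ys → Unique xs → Unique ys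
Unique-resp-↭ p = PermSetoidₚ.Unique-resp-↭ (setoid _) (↭⇒↭ₛ p)

zip-snoc : ∀ (y : A) ys (x z : A) →
           zip (y ∷ ys ++ [ x ]) ((ys ++ [ x ]) ++ [ z ]) ≡ zip (y ∷ ys) (ys ++ [ x ]) ++ [ (x , z) ]
zip-snoc y []        x z = refl
zip-snoc y (y′ ∷ ys) x z = cong ((y , y′) ∷_) (zip-snoc y′ ys x z)

cycPairs-rotate : (vs : List A) → cycPairs (rot vs) ↭ cycPairs vs
cycPairs-rotate []           = Perm.refl
cycPairs-rotate (x ∷ [])     = Perm.refl
cycPairs-rotate (x ∷ y ∷ ys) =
  subst (_↭ cycPairs (x ∷ y ∷ ys)) (sym (zip-snoc y ys x y))
    (Perm.↭-sym (Permₚ.∷↭∷ʳ (x , y) (zip (y ∷ ys) (ys ++ [ x ]))))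

walkAlong : ∀ u vs {x : Fin n} → (∀ {a b} → (a , b) ∈ zip (u ∷ vs) (vs ++ [ x ]) → Adj E a b) → Walk E u x
walkAlong u []       adj = step (adj (here refl)) here
walkAlong u (w ∷ vs) adj = step (adj (here refl)) (walkAlong w vs (adj ∘ there))

zip-∈ : ∀ {xs : List A} {ys : List B} {a b} → (a , b) ∈ zip xs ys → a ∈ xs × b ∈ ys
zip-∈ {xs = _ ∷ _} {_ ∷ _} (here refl) = here refl , here refl
zip-∈ {xs = _ ∷ _} {_ ∷ _} (there p)   = let a∈ , b∈ = zip-∈ p in there a∈ , there b∈

cycPairs-++-comm : (xs ys : List A) → cycPairs (ys ++ xs) ↭ cycPairs (xs ++ ys)
cycPairs-++-comm []       ys = Perm.↭-reflexive (cong cycPairs (Listₚ.++-identityʳ ys))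
cycPairs-++-comm (x ∷ xs) ys = begin
  cycPairs (ys ++ x ∷ xs)        ≡⟨ cong cycPairs (Listₚ.++-assoc ys [ x ] xs) ⟨
  cycPairs ((ys ++ [ x ]) ++ xs) ↭⟨ cycPairs-++-comm xs (ys ++ [ x ]) ⟩
  cycPairs (xs ++ ys ++ [ x ])   ≡⟨ cong cycPairs (Listₚ.++-assoc xs ys [ x ]) ⟨
  cycPairs ((xs ++ ys) ++ [ x ]) ↭⟨ cycPairs-rotate (x ∷ xs ++ ys) ⟩
  cycPairs (x ∷ xs ++ ys)        ∎
  where open Perm.PermutationReasoning

pair-split : ∀ (x : A) xs {y a b} → (a , b) ∈ zip (x ∷ xs) (xs ++ [ y ]) →
             (∃₂ λ pre post → x ∷ xs ≡ pre ++ a ∷ b ∷ post) ⊎ (b ≡ y × ∃ λ pre → x ∷ xs ≡ pre ++ [ a ])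
pair-split x []       (here refl) = inj₂ (refl , [] , refl)
pair-split x (z ∷ zs) (here refl) = inj₁ ([] , zs , refl)
pair-split x (z ∷ zs) (there ab∈) with pair-split z zs ab∈
... | inj₁ (pre , post , eq) = inj₁ (x ∷ pre , post , cong (x ∷_) eq)
... | inj₂ (b≡y , pre , eq)  = inj₂ (b≡y , x ∷ pre , cong (x ∷_) eq)

-- The pair lies inside the list or leads from its last vertex back to the first; either way a
-- rotation brings it to the front.
rotateTo : ∀ {vs : List A} {a b} → 3 ≤ length vs → (a , b) ∈ cycPairs vs →
           ∃ λ ys → a ∷ b ∷ ys ↭ vs × cycPairs (a ∷ b ∷ ys) ↭ cycPairs vs
rotateTo {vs = x ∷ xs} {a} {b} len ab∈ with pair-split x xs ab∈
... | inj₁ (pre , post , eq) =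
  post ++ pre ,
  subst (λ vs → a ∷ b ∷ post ++ pre ↭ vs × cycPairs (a ∷ b ∷ post ++ pre) ↭ cycPairs vs) (sym eq)
        (Permₚ.++-comm (a ∷ b ∷ post) pre , cycPairs-++-comm pre (a ∷ b ∷ post))
... | inj₂ (refl , [] , refl) = contradiction len λ { (s≤s ()) }
... | inj₂ (refl , _ ∷ pre , refl) =
  pre , Permₚ.++-comm [ a ] (x ∷ pre) , cycPairs-++-comm (x ∷ pre) [ a ]

Joins-endpoint : e Joins u , v → ∀ {a b} → e Joins a , b → u ≡ a ⊎ u ≡ b
Joins-endpoint (inj₁ (refl , refl)) (inj₁ (refl , refl)) = inj₁ refl
Joins-endpoint (inj₁ (refl , refl)) (inj₂ (refl , refl)) = inj₂ refl
Joins-endpoint (inj₂ (refl , refl)) (inj₁ (refl , refl)) = inj₂ refl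
Joins-endpoint (inj₂ (refl , refl)) (inj₂ (refl , refl)) = inj₁ refl

EdgeOfCircle⇒Joins : ∀ {vs} → EdgeOfCircle vs e → ∃₂ λ a b → (a , b) ∈ cycPairs vs × e Joins a , b
EdgeOfCircle⇒Joins (inj₁ ab∈) = _ , _ , ab∈ , inj₁ (refl , refl)
EdgeOfCircle⇒Joins (inj₂ ab∈) = _ , _ , ab∈ , inj₂ (refl , refl)

Joins⇒EdgeOfCircle : ∀ {vs} → (u , v) ∈ cycPairs vs → e Joins u , v → EdgeOfCircle vs e
Joins⇒EdgeOfCircle uv∈ (inj₁ (refl , refl)) = inj₁ uv∈
Joins⇒EdgeOfCircle uv∈ (inj₂ (refl , refl)) = inj₂ uv∈

consecutive-≢ : ∀ (u : A) vs {x a b} → Unique (u ∷ vs ++ [ x ]) →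
                (a , b) ∈ zip (u ∷ vs) (vs ++ [ x ]) → a ≢ b
consecutive-≢ u []       ((u≢ ∷ _) ∷ _) (here refl) = u≢
consecutive-≢ u (w ∷ vs) ((u≢ ∷ _) ∷ _) (here refl) = u≢
consecutive-≢ u (w ∷ vs) (_ ∷ vs!)      (there ab∈) = consecutive-≢ w vs vs! ab∈

-- The remaining pairs lead from `y` around to `x`. The first, from `y` to `z`, is not `e` because
-- `z` is not `x`; the later ones are not `e` because they avoid `y`.
circle-rest-head : ∀ {x y : Fin n} {ys} → Unique (x ∷ y ∷ ys) → 3 ≤ length (x ∷ y ∷ ys) →
                   e Joins x , y → Walk (λ g → EdgeOfCircle (x ∷ y ∷ ys) g × g ≢ e) y x
circle-rest-head {ys = []} _ (s≤s (s≤s ())) _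
circle-rest-head {n} {e} {x} {y} {z ∷ zs} vs!@((_ ∷ x≢z ∷ _) ∷ y≢zs ∷ _) _ j = walkAlong y (z ∷ zs) adj
  where
  rot! : Unique (y ∷ (z ∷ zs) ++ [ x ])
  rot! = Unique-resp-↭ (Permₚ.∷↭∷ʳ x (y ∷ z ∷ zs)) vs!
  y≢ : ∀ {a} → a ∈ (z ∷ zs) ++ [ x ] → y ≢ a
  y≢ with y≢rest ∷ _ ← rot! = All.lookup y≢rest
  distinct : ∀ {a b} → (a , b) ∈ zip (y ∷ z ∷ zs) ((z ∷ zs) ++ [ x ]) → ∀ {g} → g Joins a , b → g ≢ e
  distinct (here refl) jg refl with Joins-endpoint {e = e} j (Joins-sym {e = e} jg)
  ... | inj₁ x≡z = x≢z x≡z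
  ... | inj₂ x≡y = y≢ (∈-++⁺ʳ (z ∷ zs) (here refl)) (sym x≡y)
  distinct (there ab∈) jg refl with zip-∈ ab∈ | Joins-endpoint {e = e} (Joins-sym {e = e} j) jg
  ... | a∈ , _  | inj₁ y≡a = y≢ (∈-++⁺ˡ a∈) y≡a
  ... | _  , b∈ | inj₂ y≡b = y≢ (there b∈) y≡b
  adj : ∀ {a b} → (a , b) ∈ zip (y ∷ z ∷ zs) ((z ∷ zs) ++ [ x ]) →
        Adj (λ g → EdgeOfCircle (x ∷ y ∷ z ∷ zs) g × g ≢ e) a b
  adj ab∈ = let g , jg = edgeBetween (consecutive-≢ y (z ∷ zs) rot! ab∈) in
            g , (Joins⇒EdgeOfCircle {e = g} {vs = x ∷ y ∷ z ∷ zs} (there ab∈) jg , distinct ab∈ {g} jg) , jg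

circle-rest : ∀ {vs} → IsCircle vs → EdgeOfCircle vs e → Joined (λ g → EdgeOfCircle vs g × g ≢ e) e
circle-rest {e = e} {vs} (vs! , len) e∈ with EdgeOfCircle⇒Joins {e = e} {vs = vs} e∈
... | a , b , ab∈ , j with rotateTo len ab∈
...   | ys , perm , pairs =
  walkToJoined j (walk-map (λ g (g∈ , g≢e) → back {g} g∈ , g≢e)
    (circle-rest-head {e = e} (Unique-resp-↭ (Perm.↭-sym perm) vs!)
      (subst (3 ≤_) (sym (↭-length perm)) len) j))
  where
  back : ∀ {g} → EdgeOfCircle (a ∷ b ∷ ys) g → EdgeOfCircle vs g
  back (inj₁ p) = inj₁ (∈-resp-↭ pairs p)
  back (inj₂ p) = inj₂ (∈-resp-↭ pairs p)
  walkToJoined : ∀ {E} → e Joins a , b → Walk E b a → Joined E e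
  walkToJoined (inj₁ (refl , refl)) = walk-sym
  walkToJoined (inj₂ (refl , refl)) = id

-- Bridges and exchange in spanning trees

Minus : EdgePred n → Edge n → EdgePred n
Minus E e g = E g × g ≢ e

infix 4 _≟ᴱ_
_≟ᴱ_ : (e f : Edge n) → Dec (e ≡ f)
e ≟ᴱ f = map′ (λ (p , q) → edge-ext p q) (λ { refl → refl , refl }) (lo e Fin.≟ lo f ×-dec hi e Fin.≟ hi f)

-- A detour around `e` would close up to a circle inside `E`. With the converse `¬joined⇒forest`
-- this replaces circles by bridges in the exchange argument.
forest⇒¬joined : IsForest E → E e → ¬ Joined (Minus E e) e
forest⇒¬joined {E = E} {e} forest Ee p with circleThrough (λ (_ , e≢e) → e≢e refl) p
... | vs , circle , e∈ , rest = forest vs circle inE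
  where
  inE : ∀ g → EdgeOfCircle vs g → E g
  inE g g∈ with g ≟ᴱ e
  ... | yes refl = Ee
  ... | no  g≢e  = proj₁ (rest g g∈ g≢e)

circle-edge : ∀ {vs : List (Fin n)} → IsCircle vs → ∃ (EdgeOfCircle vs)
circle-edge {vs = x ∷ y ∷ ys} (((x≢y ∷ _) ∷ _) , _) =
  let e , j = edgeBetween x≢y in e , Joins⇒EdgeOfCircle {e = e} {vs = x ∷ y ∷ ys} (here refl) j
circle-edge {vs = _ ∷ []} (_ , s≤s ())

¬joined⇒forest : (∀ e → E e → ¬ Joined (Minus E e) e) → IsForest E
¬joined⇒forest ¬joined vs circle inE =
  let e , e∈ = circle-edge circle in
  ¬joined e (inE e e∈) (walk-map (λ g (g∈ , g≢e) → inE g g∈ , g≢e) (circle-rest circle e∈))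

exchange-tree : IsSpanningTree E → E e → ¬ Joined (Minus E e) f →
                IsSpanningTree (exchange E e f)
exchange-tree {E = E} {e} {f} (forest , conn) Ee f∉ = ¬joined⇒forest acyclic , λ u v → walk-bind joined (conn u v)
  where
  E-split : ∀ g → E g → Minus E e g ⊎ g ≡ e
  E-split g Eg with g ≟ᴱ e
  ... | yes g≡e = inj₂ g≡e
  ... | no  g≢e = inj₁ (Eg , g≢e)
  joined : ∀ g → E g → Joined (exchange E e f) g
  joined g Eg with E-split g Eg
  ... | inj₁ p    = joined-edge (inj₁ p)
  -- The walk in the tree between the ends of `f` has to use `e`, so after the exchange the ends of
  -- `e` are joined through `f`.
  ... | inj₂ refl = joined-exchange E-split (λ _ → inj₁) (inj₂ refl) (conn (lo f) (hi f)) f∉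
  acyclic-f : ¬ Joined (Minus (exchange E e f) f) f
  acyclic-f p = f∉ (walk-map (λ { g (inj₁ q , _) → q ; g (inj₂ g≡f , g≢f) → contradiction g≡f g≢f }) p)
  acyclic : ∀ g → exchange E e f g → ¬ Joined (Minus (exchange E e f) g) g
  acyclic g (inj₂ refl) = acyclic-f
  -- A detour around `g` has to use `f`, because `E` is a forest; the rest of that cycle, with `g`,
  -- joins the ends of `f` without `e`.
  acyclic g (inj₁ (Eg , g≢e)) p =
    f∉ (joined-exchange {E = Minus (Minus E e) g}
      (λ { h (inj₁ q , h≢g) → inj₁ (q , h≢g) ; h (inj₂ h≡f , _) → inj₂ h≡f })
      (λ _ → proj₁) (Eg , g≢e) p
      (λ q → forest⇒¬joined forest Eg (walk-map (λ h ((Eh , _) , h≢g) → Eh , h≢g) q)))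

exchange-self : IsSpanningTree E → E e → IsSpanningTree (exchange E e e)
exchange-self {E = E} {e} (forest , conn) Ee =
    (λ vs circle all → forest vs circle λ g g∈ → forget g (all g g∈))
  , λ u v → walk-map remember (conn u v)
  where
  forget : ∀ g → exchange E e e g → E g
  forget g (inj₁ (Eg , _)) = Eg
  forget g (inj₂ refl)     = Ee
  remember : ∀ g → E g → exchange E e e g
  remember g Eg with g ≟ᴱ e
  ... | yes g≡e = inj₂ g≡e
  ... | no  g≢e = inj₁ (Eg , g≢e)

-- The complete graph

edgeTo : (v : Fin n) → Fin (toℕ v) → Edge n
edgeTo v i = mkEdge (Fin.inject i) v (subst (_< toℕ v) (sym (Finₚ.toℕ-inject i)) (Finₚ.toℕ<n i))

edgesTo : Fin n → List (Edge n)
edgesTo v = map (edgeTo v) (allFin (toℕ v))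

∈-edgesTo⁺ : (e : Edge n) → e ∈ edgesTo (hi e)
∈-edgesTo⁺ e = subst (_∈ edgesTo (hi e)) (edge-ext lo≡ refl) (∈-map⁺ (edgeTo (hi e)) (∈-allFin (fromℕ< (lo<hi e))))
  where
  lo≡ : Fin.inject {i = hi e} (fromℕ< (lo<hi e)) ≡ lo e
  lo≡ = Finₚ.toℕ-injective (trans (Finₚ.toℕ-inject (fromℕ< (lo<hi e))) (Finₚ.toℕ-fromℕ< (lo<hi e)))

∈-edgesTo⁻ : e ∈ edgesTo v → hi e ≡ v
∈-edgesTo⁻ {v = v} e∈ with ∈-map⁻ (edgeTo v) e∈
... | _ , _ , refl = refl

edgesTo-Unique : (v : Fin n) → Unique (edgesTo v)
edgesTo-Unique v = Uniqueₚ.map⁺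
  (λ {i} {j} eq → Finₚ.toℕ-injective
    (trans (sym (Finₚ.toℕ-inject i)) (trans (cong (toℕ ∘ lo) eq) (Finₚ.toℕ-inject j))))
  (Uniqueₚ.allFin⁺ (toℕ v))

length-edgesTo : (v : Fin n) → length (edgesTo v) ≡ toℕ v
length-edgesTo v = trans (Listₚ.length-map (edgeTo v) (allFin (toℕ v))) (Listₚ.length-tabulate id)

-- Larger upper ends come first, so that `T-complete` can peel off one vertex at a time from the
-- front of the list.
edgesBelow : ∀ k → k ≤ n → List (Edge n)
edgesBelow zero    _   = []
edgesBelow (suc k) k<n = edgesTo (fromℕ< k<n) ++ edgesBelow k (ℕₚ.<⇒≤ k<n)

∈-edgesBelow⁺ : (k≤n : k ≤ n) → toℕ (hi e) < k → e ∈ edgesBelow k k≤n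
∈-edgesBelow⁺ {suc k} {e = e} k<n hi<k with toℕ (hi e) ℕₚ.≟ k
... | yes refl = ∈-++⁺ˡ (subst (λ v → e ∈ edgesTo v) (sym (Finₚ.fromℕ<-toℕ (hi e) k<n)) (∈-edgesTo⁺ e))
... | no  hi≢k = ∈-++⁺ʳ (edgesTo (fromℕ< k<n)) (∈-edgesBelow⁺ (ℕₚ.<⇒≤ k<n) (ℕₚ.≤∧≢⇒< (ℕₚ.≤-pred hi<k) hi≢k))

∈-edgesBelow⁻ : (k≤n : k ≤ n) → e ∈ edgesBelow k k≤n → toℕ (hi e) < k
∈-edgesBelow⁻ {suc k} k<n e∈ with ∈-++⁻ (edgesTo (fromℕ< k<n)) e∈
... | inj₁ e∈top = s≤s (ℕₚ.≤-reflexive (trans (cong toℕ (∈-edgesTo⁻ e∈top)) (Finₚ.toℕ-fromℕ< k<n)))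
... | inj₂ e∈low = ℕₚ.m<n⇒m<1+n (∈-edgesBelow⁻ (ℕₚ.<⇒≤ k<n) e∈low)

edgesBelow-Unique : (k≤n : k ≤ n) → Unique (edgesBelow k k≤n)
edgesBelow-Unique {zero}  _   = []
edgesBelow-Unique {suc k} k<n =
  Uniqueₚ.++⁺ (edgesTo-Unique _) (edgesBelow-Unique (ℕₚ.<⇒≤ k<n))
    λ { (e∈top , e∈low) → ℕₚ.<-irrefl
          (trans (cong toℕ (∈-edgesTo⁻ e∈top)) (Finₚ.toℕ-fromℕ< k<n)) (∈-edgesBelow⁻ (ℕₚ.<⇒≤ k<n) e∈low) }

allEdges : ∀ n → List (Edge n)
allEdges n = edgesBelow n ℕₚ.≤-refl

∈-allEdges : (e : Edge n) → e ∈ allEdges n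
∈-allEdges e = ∈-edgesBelow⁺ ℕₚ.≤-refl (Finₚ.toℕ<n (hi e))

isolated-walk : (∀ e → E e → lo e ≢ u × hi e ≢ u) → Walk E u v → u ≡ v
isolated-walk iso here = refl
isolated-walk iso (step (e , Ee , inj₁ (refl , _)) _) = contradiction refl (proj₁ (iso e Ee))
isolated-walk iso (step (e , Ee , inj₂ (_ , refl)) _) = contradiction refl (proj₂ (iso e Ee))

-- Peeling off the top vertex of the complete graph

open Graphic

-- Contracting S turns the complete graph into the complete graph on the vertices < k.
record Pendants {n : ℕ} (k : ℕ) (S : List (Edge (suc n))) : Set where
  field
    at-zero : ∀ {s} → s ∈ S → lo s ≡ zero × k ≤ toℕ (hi s)
    covers  : ∀ v → k ≤ toℕ v → Walk (_∈ S) zero v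

-- One round of the product: contracting `S` has merged all vertices above `top` with vertex `zero`,
-- and `low` lists the edges among the vertices below `top`.
module Star {n k : ℕ} (k<n : suc k < suc n) {S : List (Edge (suc n))} (pendants : Pendants (suc (suc k)) S) where
  open Pendants pendants

  top : Fin (suc n)
  top = fromℕ< k<n

  toℕ-top : toℕ top ≡ suc k
  toℕ-top = Finₚ.toℕ-fromℕ< k<n

  low : List (Edge (suc n))
  low = edgesBelow (suc k) (ℕₚ.<⇒≤ k<n)

  isolated-S : u ≢ zero → toℕ u ≤ suc k → ∀ e → e ∈ S → lo e ≢ u × hi e ≢ u
  isolated-S u≢0 u≤ e e∈ =
      (λ lo≡u → u≢0 (trans (sym lo≡u) (proj₁ (at-zero e∈))))
    , (λ hi≡u → ℕₚ.<⇒≱ (proj₂ (at-zero e∈)) (subst (λ w → toℕ w ≤ suc k) (sym hi≡u) u≤))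

  top≢0 : top ≢ zero
  top≢0 eq with () ← trans (sym toℕ-top) (cong toℕ eq)

  isolated-top : ∀ e → e ∈ S ++ low → lo e ≢ top × hi e ≢ top
  isolated-top e e∈ with ∈-++⁻ S e∈
  ... | inj₁ e∈S = isolated-S top≢0 (ℕₚ.≤-reflexive toℕ-top) e e∈S
  ... | inj₂ e∈low =
      (λ { refl → ℕₚ.<-asym (lo<hi e) (subst (toℕ (hi e) <_) (sym toℕ-top) hi<) })
    , (λ hi≡ → ℕₚ.<-irrefl (trans (cong toℕ hi≡) toℕ-top) hi<)
    where hi< = ∈-edgesBelow⁻ (ℕₚ.<⇒≤ k<n) e∈low

  ToTop : Edge (suc n) → Set
  ToTop e = hi e ≡ top

  lo<top : ∀ {e} → ToTop e → toℕ (lo e) < suc k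
  lo<top {e} refl = subst (toℕ (lo e) <_) toℕ-top (lo<hi e)

  coloop-top : ∀ e → ToTop e → ¬ Span (S ++ low) e
  coloop-top e refl p = lo≢hi e (sym (isolated-walk isolated-top (walk-sym p)))

  ¬walk-S : u ≢ v → toℕ u ≤ suc k → toℕ v ≤ suc k → ¬ Walk (_∈ S) u v
  ¬walk-S {u} {v} u≢v u≤ v≤ p with u Fin.≟ zero
  ... | no  u≢0  = u≢v (isolated-walk (isolated-S u≢0 u≤) p)
  ... | yes refl = u≢v (sym (isolated-walk (isolated-S (u≢v ∘ sym) v≤) (walk-sym p)))

  ¬span-two : ToTop e → ToTop f → e ≢ f → ¬ Span (f ∷ S) e
  ¬span-two {e} {f} e⊤ f⊤ e≢f p with walk-split (∈-∷⁻ S) p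
  ... | inj₁ q              = coloop-top e e⊤ (walk-map (λ _ → ∈-++⁺ˡ) q)
  ... | inj₂ (inj₁ (q , _)) = ¬walk-S (λ lo≡ → e≢f (edge-ext lo≡ (trans e⊤ (sym f⊤))))
                                (ℕₚ.<⇒≤ (lo<top {e} e⊤)) (ℕₚ.<⇒≤ (lo<top {f} f⊤)) q
  ... | inj₂ (inj₂ (q , _)) = coloop-top e e⊤ (walk-map (λ _ → ∈-++⁺ˡ) (subst (Walk _ (lo e)) (trans f⊤ (sym e⊤)) q))

  third-edge : ToTop e → ToTop f → e ≢ f → ∃ λ g → g ∈ low × g Joins lo e , lo f
  third-edge {e} {f} e⊤ f⊤ e≢f =
    let g , j = edgeBetween (λ lo≡ → e≢f (edge-ext lo≡ (trans e⊤ (sym f⊤)))) in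
    g , ∈-edgesBelow⁺ _ (hi< g j) , j
    where
    hi< : ∀ g → g Joins lo e , lo f → toℕ (hi g) < suc k
    hi< g (inj₁ (_ , refl)) = lo<top {f} f⊤
    hi< g (inj₂ (_ , refl)) = lo<top {e} e⊤

  T-choose-one : ∀ {f} X → ToTop f → All ToTop X → All (f ≢_) X → T (f ∷ S) (X ++ low) ≗ T (f ∷ S) low
  T-choose-one [] f⊤ _ _ k = refl
  T-choose-one {f} (g ∷ X) f⊤ (g⊤ ∷ X⊤) (f≢g ∷ f∉X) j = begin
    T (f ∷ S) (g ∷ X ++ low) j
      ≡⟨ T-nonloop (X ++ low) (¬span-two g⊤ f⊤ (f≢g ∘ sym)) j ⟩
    T (f ∷ S) (X ++ low) j + weigh d (T (g ∷ f ∷ S) (X ++ low)) j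
      ≡⟨ cong₂ _+_ (T-choose-one X f⊤ X⊤ f∉X j) (weigh-zero d (T-hasLoop (X ++ low) (∈-++⁺ʳ X h∈) h-loop) j) ⟩
    T (f ∷ S) low j + 0
      ≡⟨ ℕₚ.+-identityʳ _ ⟩
    T (f ∷ S) low j
      ∎
    where
    open ≡-Reasoning
    d = walk? ((f ∷ S) ++ X ++ low) (lo g) (hi g)
    third = third-edge f⊤ g⊤ f≢g
    h = proj₁ third
    h∈ = proj₁ (proj₂ third)
    through-top : Walk (_∈ g ∷ f ∷ S) (lo f) (lo g)
    through-top = walk-trans (joined-edge {e = f} (there (here refl)))
      (subst (λ w → Walk (_∈ g ∷ f ∷ S) w (lo g)) (trans g⊤ (sym f⊤)) (walk-sym (joined-edge {e = g} (here refl))))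
    h-loop : Span (g ∷ f ∷ S) h
    h-loop with proj₂ (proj₂ third)
    ... | inj₁ (p , q) = subst₂ (Walk _) (sym p) (sym q) through-top
    ... | inj₂ (p , q) = subst₂ (Walk _) (sym p) (sym q) (walk-sym through-top)

  T-none : ∀ j → T S low j ≡ 0
  T-none = T-nonspanning low λ span →
    top≢0 (isolated-walk isolated-top (allJoined⇒Connected span top zero))

  module _ {p : Poly} (T-one : ∀ f → ToTop f → T (f ∷ S) low ≗ p) where

    T-star : ∀ f X → ToTop f → All ToTop X → Unique (f ∷ X) →
             ∀ j → T S (f ∷ X ++ low) j ≡ length X * p j + x· p j
    T-star f X f⊤ X⊤ (f∉X ∷ X!) j =
      trans (T-nonloop (X ++ low) (coloop-top f f⊤ ∘ walk-map (λ _ → ∈-++⁺ˡ)) j) (rest X X⊤ f∉X X!)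
      where
      open ≡-Reasoning
      rest : ∀ X → All ToTop X → All (f ≢_) X → Unique X →
             T S (X ++ low) j + weigh (walk? (S ++ X ++ low) (lo f) (hi f)) (T (f ∷ S) (X ++ low)) j
             ≡ length X * p j + x· p j
      rest [] _ _ _ with walk? (S ++ low) (lo f) (hi f)
      ... | yes f∈ = contradiction f∈ (coloop-top f f⊤)
      ... | no  _  = cong₂ _+_ (T-none j) (x·-cong (T-one f f⊤) j)
      rest (g ∷ X) (g⊤ ∷ X⊤) (f≢g ∷ f∉X) gX! with walk? (S ++ (g ∷ X) ++ low) (lo f) (hi f)
      -- As long as another edge `g` to `top` remains, `f` is no coloop: `g` and the edge of `low`
      -- between the lower ends bypass it.
      ... | no  f∉ = contradiction (joined (third-edge f⊤ g⊤ f≢g)) f∉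
        where
        joined : (∃ λ h → h ∈ low × h Joins lo f , lo g) → Span (S ++ (g ∷ X) ++ low) f
        joined (h , h∈ , jh) =
          walk-trans (walk-edge {e = h} (∈-++⁺ʳ S (there (∈-++⁺ʳ X h∈))) jh)
            (subst (Walk _ (lo g)) (trans g⊤ (sym f⊤)) (joined-edge {e = g} (∈-++⁺ʳ S (here refl))))
      ... | yes _ = begin
        T S (g ∷ X ++ low) j + T (f ∷ S) ((g ∷ X) ++ low) j
          ≡⟨ cong₂ _+_ (T-star g X g⊤ X⊤ gX! j)
                       (trans (T-choose-one (g ∷ X) f⊤ (g⊤ ∷ X⊤) (f≢g ∷ f∉X) j) (T-one f f⊤ j)) ⟩
        length X * p j + x· p j + p j
          ≡⟨ ℕₚ.+-comm (length X * p j + x· p j) (p j) ⟩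
        p j + (length X * p j + x· p j)
          ≡⟨ ℕₚ.+-assoc (p j) (length X * p j) (x· p j) ⟨
        p j + length X * p j + x· p j
          ∎

T-complete : ∀ k (k<n : k < suc n) {S} → Pendants (suc k) S → T S (edgesBelow (suc k) k<n) ≗ rising k
T-complete zero k<n {S} pendants j with spanning? S
... | yes _ = refl
... | no ¬span = contradiction (λ e → walk-trans (walk-sym (fromZero (lo e))) (fromZero (hi e))) ¬span
  where
  fromZero : ∀ v → Walk (_∈ S) zero v
  fromZero zero    = here
  fromZero (suc v) = Pendants.covers pendants (suc v) (s≤s z≤n)
T-complete {n} (suc k) k<n {S} pendants j =
  go (edgesTo top) (length-edgesTo top) (All.tabulate ∈-edgesTo⁻) (edgesTo-Unique top)
  where
  open Star k<n pendants
  -- By `T-coloops` it is irrelevant which edge to `top` is contracted. The one at vertex `zero` is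
  -- the normal form that keeps the contracted set a star.
  pendant : Edge (suc n)
  pendant = mkEdge zero top (subst (0 <_) (sym toℕ-top) (s≤s z≤n))
  pendants′ : Pendants (suc k) (pendant ∷ S)
  pendants′ = record
    { at-zero = λ { (here refl) → refl , ℕₚ.≤-reflexive (sym toℕ-top)
                  ; (there s∈)  → let lo≡ , hi≥ = Pendants.at-zero pendants s∈ in lo≡ , ℕₚ.<⇒≤ hi≥ }
    ; covers  = covers′ }
    where
    covers′ : ∀ v → suc k ≤ toℕ v → Walk (_∈ pendant ∷ S) zero v
    covers′ v k≤v with suc k ℕₚ.≟ toℕ v
    ... | yes k≡v = subst (Walk _ zero) (Finₚ.toℕ-injective (trans toℕ-top k≡v))
                          (joined-edge {e = pendant} (here refl))
    ... | no  k≢v = walk-map (λ _ → there) (Pendants.covers pendants v (ℕₚ.≤∧≢⇒< k≤v k≢v))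
  T-one : ∀ f → ToTop f → T (f ∷ S) low ≗ rising k
  T-one f f⊤ j = trans (T-coloops low (coloop-top f f⊤) (coloop-top pendant refl) j)
                       (T-complete k (ℕₚ.<⇒≤ k<n) pendants′ j)
  go : ∀ X → length X ≡ toℕ top → All ToTop X → Unique X → T S (X ++ low) j ≡ rising (suc k) j
  go [] len _ _ with () ← trans len toℕ-top
  go (f ∷ X) len (f⊤ ∷ X⊤) X! =
    -- `top` has `suc k` smaller neighbours and `X` lists the edges to all but one of them, which
    -- makes the new factor x + k.
    trans (T-star T-one f X f⊤ X⊤ X! j)
          (cong (λ l → l * rising k j + x· (rising k) j) (ℕₚ.suc-injective (trans len toℕ-top)))

T-allEdges : ∀ n → T [] (allEdges (suc n)) ≗ rising n
T-allEdges n = T-complete n ℕₚ.≤-refl record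
  { at-zero = λ () ; covers = λ v n<v → contradiction n<v (ℕₚ.<⇒≱ (Finₚ.toℕ<n v)) }

-- NBC bases

consIf : Bool → A → List A → List A
consIf true  x xs = x ∷ xs
consIf false x xs = xs

consUnless : Dec B → A → List A → List A
consUnless (yes _) x xs = xs
consUnless (no  _) x xs = x ∷ xs

-- Coding subsets by bit vectors lets the count follow the same recursion along `L` as `T`.
chosen : (L : List A) → Vec Bool (length L) → List A
chosen []      []      = []
chosen (f ∷ L) (c ∷ b) = consIf c f (chosen L b)

chosen-⊆ : (L : List A) (b : Vec Bool (length L)) → chosen L b ⊆ L
chosen-⊆ []      []          ()
chosen-⊆ (f ∷ L) (true ∷ b)  (here refl) = here refl
chosen-⊆ (f ∷ L) (true ∷ b)  (there g∈)  = there (chosen-⊆ L b g∈)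
chosen-⊆ (f ∷ L) (false ∷ b) g∈          = there (chosen-⊆ L b g∈)

∈-consIf⁺ : ∀ c {x y : A} {xs} → y ∈ xs → y ∈ consIf c x xs
∈-consIf⁺ true  = there
∈-consIf⁺ false = id

∈-consIf⁻ : ∀ c {x y : A} {xs} → y ∈ consIf c x xs → (c ≡ true × y ≡ x) ⊎ y ∈ xs
∈-consIf⁻ true  (here refl) = inj₁ (refl , refl)
∈-consIf⁻ true  (there y∈)  = inj₂ y∈
∈-consIf⁻ false y∈          = inj₂ y∈

∈-consIf-move : ∀ c {x y : A} {xs ys} → y ∈ consIf c x xs → y ∈ xs ⊎ y ∈ consIf c x ys
∈-consIf-move true  (here y≡x) = inj₂ (here y≡x)
∈-consIf-move true  (there y∈) = inj₁ y∈
∈-consIf-move false y∈         = inj₁ y∈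

chosen-injective : {L : List A} → Unique L → (b b′ : Vec Bool (length L)) →
                   (∀ e → e ∈ chosen L b → e ∈ chosen L b′) → (∀ e → e ∈ chosen L b′ → e ∈ chosen L b) → b ≡ b′
chosen-injective [] [] [] _ _ = refl
chosen-injective {L = f ∷ L} (f∉L ∷ L!) (c ∷ b) (c′ ∷ b′) ⊆₁ ⊆₂ =
  cong₂ _∷_ (head≡ c c′ ⊆₁ ⊆₂) (chosen-injective L! b b′ (tail⊆ c c′ b b′ ⊆₁) (tail⊆ c′ c b′ b ⊆₂))
  where
  absent : ∀ b → f ∉ chosen L b
  absent b f∈ = All.lookup f∉L (chosen-⊆ L b f∈) refl
  head≡ : ∀ c c′ → (∀ e → e ∈ consIf c f (chosen L b) → e ∈ consIf c′ f (chosen L b′)) →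
          (∀ e → e ∈ consIf c′ f (chosen L b′) → e ∈ consIf c f (chosen L b)) → c ≡ c′
  head≡ true  true  _  _  = refl
  head≡ true  false ⊆₁ _  = contradiction (⊆₁ f (here refl)) (absent b′)
  head≡ false true  _  ⊆₂ = contradiction (⊆₂ f (here refl)) (absent b)
  head≡ false false _  _  = refl
  tail⊆ : ∀ c c′ b b′ → (∀ e → e ∈ consIf c f (chosen L b) → e ∈ consIf c′ f (chosen L b′)) →
          ∀ e → e ∈ chosen L b → e ∈ chosen L b′
  tail⊆ c c′ b b′ ⊆ e e∈ with ∈-consIf⁻ c′ (⊆ e (∈-consIf⁺ c e∈))
  ... | inj₁ (_ , refl) = contradiction e∈ (absent b)
  ... | inj₂ e∈′        = e∈′

choose : (A → Bool) → (L : List A) → Vec Bool (length L)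
choose p []      = []
choose p (f ∷ L) = p f ∷ choose p L

∈-choose⁺ : (p : A → Bool) → ∀ {e L} → e ∈ L → p e ≡ true → e ∈ chosen L (choose p L)
∈-choose⁺ p {e} (here refl) pe rewrite pe = here refl
∈-choose⁺ p {L = f ∷ _} (there e∈) pe = ∈-consIf⁺ (p f) (∈-choose⁺ p e∈ pe)

∈-choose⁻ : (p : A → Bool) → ∀ {e} L → e ∈ chosen L (choose p L) → p e ≡ true
∈-choose⁻ p (f ∷ L) e∈ with ∈-consIf⁻ (p f) e∈
... | inj₁ (pf , refl) = pf
... | inj₂ e∈L         = ∈-choose⁻ p L e∈L

-- Read with L in decreasing order: the edges of S are the ones already chosen, and every edge of L,
-- chosen or not, must fail to be spanned by the chosen edges that precede it.
Admissible : (S L : List (Edge n)) → Vec Bool (length L) → Set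
Admissible S []      []      = ∀ e → Span S e
Admissible S (f ∷ L) (c ∷ b) = ¬ Span S f × Admissible (consIf c f S) L b

-- When `f` is read, `S` holds the larger chosen edges and `L` all smaller ones; the test is the one
-- by which `weigh` assigns the factor x.
actives : (S L : List (Edge n)) → Vec Bool (length L) → List (Edge n)
actives S []      []          = []
actives S (f ∷ L) (true ∷ b)  = consUnless (walk? (S ++ L) (lo f) (hi f)) f (actives (f ∷ S) L b)
actives S (f ∷ L) (false ∷ b) = actives S L b

HasCard-Bool∷ : {P Q : Vec Bool n → Set} {R : Vec Bool (suc n) → Set} {l m : ℕ} →
                (∀ b → P b ⇔ R (false ∷ b)) → (∀ b → Q b ⇔ R (true ∷ b)) →
                HasCard P l → HasCard Q m → HasCard R (l + m)
HasCard-Bool∷ {n} P⇔ Q⇔ cardP cardQ =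
  HasCard-cong
    (λ { (false ∷ b) → mk⇔ (λ { (inj₁ (_ , refl , Pb)) → to (P⇔ b) Pb ; (inj₂ (_ , () , _)) })
                           (λ Rb → inj₁ (b , refl , from (P⇔ b) Rb))
       ; (true ∷ b)  → mk⇔ (λ { (inj₁ (_ , () , _)) ; (inj₂ (_ , refl , Qb)) → to (Q⇔ b) Qb })
                           (λ Rb → inj₂ (b , refl , from (Q⇔ b) Rb)) })
    (HasCard-⊎ (λ { _ (_ , refl , _) (_ , () , _) }) (prefix false cardP) (prefix true cardQ))
  where
  prefix : ∀ c {P : Vec Bool n → Set} {l} → HasCard P l → HasCard (λ v → ∃ λ b → v ≡ c ∷ b × P b) l
  prefix c = HasCard-bij (c ∷_) (λ b Pb → b , refl , Pb) (λ _ _ → Vecₚ.∷-injectiveʳ)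
               (λ { _ (b , refl , Pb) → b , Pb , refl })

-- Deletion and contraction is the case distinction on the first bit: `false` leaves `S` as it is,
-- `true` adds `f` to it.
card-Admissible : (S L : List (Edge n)) → ∀ k →
  HasCard (λ b → Admissible S L b × length (actives S L b) ≡ k) (T S L k)
card-Admissible S [] k with spanning? S | k
... | no ¬span | _     = HasCard-∅ λ { [] (span , _) → ¬span span }
... | yes span | zero  = HasCard-singleton [] (span , refl) (λ { [] _ → refl })
... | yes span | suc _ = HasCard-∅ λ { [] (_ , ()) }
card-Admissible S (f ∷ L) k with walk? S (lo f) (hi f)
... | yes f∈ = HasCard-∅ λ { (_ ∷ _) ((f∉ , _) , _) → f∉ f∈ }
... | no  f∉ =
  HasCard-Bool∷
    (λ b → mk⇔ (λ (adm , len) → (f∉ , adm) , len) (λ ((_ , adm) , len) → adm , len))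
    (λ b → mk⇔ (λ (adm , len) → (f∉ , adm) , len) (λ ((_ , adm) , len) → adm , len))
    (card-Admissible S L k)
    (weighted (walk? (S ++ L) (lo f) (hi f)) k)
  where
  weighted : (d : Dec (Span (S ++ L) f)) → ∀ k →
    HasCard (λ b → Admissible (f ∷ S) L b × length (consUnless d f (actives (f ∷ S) L b)) ≡ k)
            (weigh d (T (f ∷ S) L) k)
  weighted (yes _) k       = card-Admissible (f ∷ S) L k
  weighted (no  _) zero    = HasCard-∅ λ { _ (_ , ()) }
  weighted (no  _) (suc k) =
    HasCard-cong (λ b → mk⇔ (λ (adm , len) → adm , cong suc len) (λ (adm , len) → adm , ℕₚ.suc-injective len))
      (card-Admissible (f ∷ S) L k)

∈-consUnless⁻ : (d : Dec B) → ∀ {x y : A} {xs} → y ∈ consUnless d x xs → (¬ B × y ≡ x) ⊎ y ∈ xs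
∈-consUnless⁻ (yes _) y∈           = inj₂ y∈
∈-consUnless⁻ (no ¬b) (here refl)  = inj₁ (¬b , refl)
∈-consUnless⁻ (no _)  (there y∈)   = inj₂ y∈

∈-consUnless⁺ : (d : Dec B) → ∀ {x y : A} {xs} → (¬ B × y ≡ x) ⊎ y ∈ xs → y ∈ consUnless d x xs
∈-consUnless⁺ (yes b) (inj₁ (¬b , _)) = contradiction b ¬b
∈-consUnless⁺ (yes _) (inj₂ y∈)       = y∈
∈-consUnless⁺ (no _)  (inj₁ (_ , y≡)) = here y≡
∈-consUnless⁺ (no _)  (inj₂ y∈)       = there y∈

actives-⊆ : (S L : List (Edge n)) (b : Vec Bool (length L)) → actives S L b ⊆ chosen L b
actives-⊆ S []      []          ()
actives-⊆ S (f ∷ L) (false ∷ b) e∈ = actives-⊆ S L b e∈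
actives-⊆ S (f ∷ L) (true ∷ b)  e∈ with ∈-consUnless⁻ (walk? (S ++ L) (lo f) (hi f)) e∈
... | inj₁ (_ , refl) = here refl
... | inj₂ e∈L        = there (actives-⊆ (f ∷ S) L b e∈L)

actives-Unique : ∀ S {L : List (Edge n)} (b : Vec Bool (length L)) → Unique L → Unique (actives S L b)
actives-Unique S {[]}    []          _          = []
actives-Unique S {f ∷ L} (false ∷ b) (_ ∷ L!)   = actives-Unique S b L!
actives-Unique S {f ∷ L} (true ∷ b)  (f∉L ∷ L!) with walk? (S ++ L) (lo f) (hi f)
... | yes _ = actives-Unique (f ∷ S) b L!
... | no  _ = All.tabulate (λ e∈ → All.lookup f∉L (chosen-⊆ L b (actives-⊆ (f ∷ S) L b e∈)))
              ∷ actives-Unique (f ∷ S) b L!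

-- Scans along a given edge order

module Ordered {n : ℕ} (o : EdgeOrder n) where
  _≺_ : Edge n → Edge n → Set
  _≺_ = proj₁ o

  open IsStrictTotalOrder (proj₂ o) using (compare; irrefl; asym) renaming (trans to ≺-trans)

  Decreasing : List (Edge n) → Set
  Decreasing = AllPairs (λ e f → f ≺ e)

  insert : ∀ e {L} → Decreasing L → e ∉ L → ∃ λ L′ → L′ ↭ e ∷ L × Decreasing L′
  insert e [] _ = [ e ] , Perm.refl , [] ∷ []
  insert e {f ∷ L} (L≺f ∷ dec) e∉ with compare e f
  ... | tri≈ _ e≡f _ = contradiction (here e≡f) e∉
  ... | tri> _ _ f≺e = e ∷ f ∷ L , Perm.refl , (f≺e ∷ All.map (λ g≺f → ≺-trans g≺f f≺e) L≺f) ∷ L≺f ∷ dec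
  ... | tri< e≺f _ _ with insert e dec (e∉ ∘ there)
  ...   | L′ , perm , dec′ =
    f ∷ L′ , Perm.trans (Perm.prep f perm) (Perm.swap f e Perm.refl) ,
    Permₚ.All-resp-↭ (Perm.↭-sym perm) (e≺f ∷ L≺f) ∷ dec′

  sortDecreasing : ∀ {L} → Unique L → ∃ λ L′ → L′ ↭ L × Decreasing L′
  sortDecreasing [] = [] , Perm.refl , []
  sortDecreasing {e ∷ L} (e∉L ∷ L!) with sortDecreasing L!
  ... | L′ , perm , dec with insert e dec (λ e∈ → All.lookup e∉L (∈-resp-↭ perm e∈) refl)
  ...   | L″ , perm′ , dec′ = L″ , Perm.trans perm′ (Perm.prep e perm) , dec′

  -- The edges chosen before `f` is read. Splitting them between `S` and `B` makes the predicate
  -- invariant when the head of the scanned list moves from `B` to `S`, as the inductions require.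
  Prior : (S B : List (Edge n)) → Edge n → EdgePred n
  Prior S B f g = g ∈ S ⊎ (g ∈ B × f ≺ g)

  Prior-shift : ∀ c {S B e f} → e ≺ f → ∀ g → Prior S (consIf c f B) e g ⇔ Prior (consIf c f S) B e g
  Prior-shift false         e≺f g = mk⇔ id id
  Prior-shift true  {S} {B} {e} {f} e≺f g = mk⇔ ⇒ ⇐
    where
    ⇒ : Prior S (f ∷ B) e g → Prior (f ∷ S) B e g
    ⇒ (inj₁ g∈S)               = inj₁ (there g∈S)
    ⇒ (inj₂ (here refl , _))   = inj₁ (here refl)
    ⇒ (inj₂ (there g∈B , e≺g)) = inj₂ (g∈B , e≺g)
    ⇐ : Prior (f ∷ S) B e g → Prior S (f ∷ B) e g
    ⇐ (inj₁ (here refl))   = inj₂ (here refl , e≺f)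
    ⇐ (inj₁ (there g∈S))   = inj₁ g∈S
    ⇐ (inj₂ (g∈B , e≺g))   = inj₂ (there g∈B , e≺g)

  Prior-head : ∀ c {S L f} (b : Vec Bool (length L)) → All (_≺ f) L → ∀ g →
               Prior S (consIf c f (chosen L b)) f g → g ∈ S
  Prior-head c b L≺f g (inj₁ g∈S) = g∈S
  Prior-head c {L = L} b L≺f g (inj₂ (g∈ , f≺g)) with ∈-consIf⁻ c g∈
  ... | inj₁ (_ , refl) = contradiction f≺g (irrefl refl)
  ... | inj₂ g∈L        = contradiction f≺g (asym (All.lookup L≺f (chosen-⊆ L b g∈L)))

  Admissible⇒ : ∀ {S L} (b : Vec Bool (length L)) → Decreasing L → Admissible S L b →
    (∀ f → f ∈ L → ¬ Joined (Prior S (chosen L b) f) f) × (∀ e → Joined (λ g → g ∈ S ⊎ g ∈ chosen L b) e)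
  Admissible⇒ {L = []} [] _ span = (λ _ ()) , λ e → walk-map (λ _ → inj₁) (span e)
  Admissible⇒ {S} {f ∷ L} (c ∷ b) (L≺f ∷ dec) (f∉ , adm) with Admissible⇒ b dec adm
  ... | nbc , span = nbc′ , λ e → walk-map shift (span e)
    where
    nbc′ : ∀ e → e ∈ f ∷ L → ¬ Joined (Prior S (consIf c f (chosen L b)) e) e
    nbc′ e (here refl) p = f∉ (walk-map (Prior-head c b L≺f) p)
    nbc′ e (there e∈)  p = nbc e e∈ (walk-map (λ g → to (Prior-shift c (All.lookup L≺f e∈) g)) p)
    shift : ∀ g → g ∈ consIf c f S ⊎ g ∈ chosen L b → g ∈ S ⊎ g ∈ consIf c f (chosen L b)
    shift g (inj₂ g∈) = inj₂ (∈-consIf⁺ c g∈)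
    shift g (inj₁ g∈) = ∈-consIf-move c g∈

  ⇒Admissible : ∀ {S L} (b : Vec Bool (length L)) → Decreasing L →
    (∀ f → f ∈ L → ¬ Joined (Prior S (chosen L b) f) f) → (∀ e → Joined (λ g → g ∈ S ⊎ g ∈ chosen L b) e) →
    Admissible S L b
  ⇒Admissible {L = []} [] _ _ span e = walk-map (λ { _ (inj₁ g∈) → g∈ ; _ (inj₂ ()) }) (span e)
  ⇒Admissible {S} {f ∷ L} (c ∷ b) (L≺f ∷ dec) nbc span =
      (λ p → nbc f (here refl) (walk-map (λ _ → inj₁) p))
    , ⇒Admissible b dec
        (λ e e∈ p → nbc e (there e∈) (walk-map (λ g → from (Prior-shift c (All.lookup L≺f e∈) g)) p))
        (λ e → walk-map shift (span e))
    where
    shift : ∀ g → g ∈ S ⊎ g ∈ consIf c f (chosen L b) → g ∈ consIf c f S ⊎ g ∈ chosen L b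
    shift g (inj₁ g∈) = inj₁ (∈-consIf⁺ c g∈)
    shift g (inj₂ g∈) = Sum.swap (∈-consIf-move c g∈)

  -- This interpolates between `S ++ L`, tested in `actives` when `e` heads `L`, and, for empty `S`
  -- and complete `L`, the larger edges of the basis together with all smaller edges.
  Around : (S B L : List (Edge n)) → Edge n → EdgePred n
  Around S B L e g = Prior S B e g ⊎ (g ∈ L × g ≺ e)

  Around-shift : ∀ c {S B L e f} → e ≺ f → ∀ g → Around S (consIf c f B) (f ∷ L) e g ⇔ Around (consIf c f S) B L e g
  Around-shift c {S} {B} {L} {e} {f} e≺f g = mk⇔ ⇒ ⇐
    where
    ⇒ : Around S (consIf c f B) (f ∷ L) e g → Around (consIf c f S) B L e g
    ⇒ (inj₁ p)                   = inj₁ (to (Prior-shift c e≺f g) p)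
    ⇒ (inj₂ (here refl , f≺e))   = contradiction f≺e (asym e≺f)
    ⇒ (inj₂ (there g∈L , g≺e))   = inj₂ (g∈L , g≺e)
    ⇐ : Around (consIf c f S) B L e g → Around S (consIf c f B) (f ∷ L) e g
    ⇐ (inj₁ p)           = inj₁ (from (Prior-shift c e≺f g) p)
    ⇐ (inj₂ (g∈L , g≺e)) = inj₂ (there g∈L , g≺e)

  Around-head : ∀ c {S L f} (b : Vec Bool (length L)) → All (_≺ f) L → ∀ g →
                Around S (consIf c f (chosen L b)) (f ∷ L) f g ⇔ g ∈ S ++ L
  Around-head c {S} {L} {f} b L≺f g = mk⇔ ⇒ ⇐
    where
    ⇒ : Around S (consIf c f (chosen L b)) (f ∷ L) f g → g ∈ S ++ L
    ⇒ (inj₁ p)                 = ∈-++⁺ˡ (Prior-head c b L≺f g p)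
    ⇒ (inj₂ (here refl , f≺f)) = contradiction f≺f (irrefl refl)
    ⇒ (inj₂ (there g∈L , _))   = ∈-++⁺ʳ S g∈L
    ⇐ : g ∈ S ++ L → Around S (consIf c f (chosen L b)) (f ∷ L) f g
    ⇐ g∈ with ∈-++⁻ S g∈
    ... | inj₁ g∈S = inj₁ (inj₁ g∈S)
    ... | inj₂ g∈L = inj₂ (there g∈L , All.lookup L≺f g∈L)

  ∈-actives : ∀ {S L} (b : Vec Bool (length L)) → Decreasing L → ∀ e →
              e ∈ actives S L b ⇔ (e ∈ chosen L b × ¬ Joined (Around S (chosen L b) L e) e)
  ∈-actives {L = []} [] _ e = mk⇔ (λ ()) (λ ())
  ∈-actives {S} {f ∷ L} (false ∷ b) (L≺f ∷ dec) e = mk⇔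
    (λ e∈ → let e∈B , ¬p = to IH e∈ in
            e∈B , ¬p ∘ walk-map (λ g → to (Around-shift false (≺f e∈B) g)))
    (λ (e∈B , ¬p) → from IH (e∈B , ¬p ∘ walk-map (λ g → from (Around-shift false (≺f e∈B) g))))
    where
    IH = ∈-actives {S} b dec e
    ≺f : e ∈ chosen L b → e ≺ f
    ≺f e∈ = All.lookup L≺f (chosen-⊆ L b e∈)
  ∈-actives {S} {f ∷ L} (true ∷ b) (L≺f ∷ dec) e = mk⇔ (⇒ ∘ ∈-consUnless⁻ d) (∈-consUnless⁺ d ∘ ⇐)
    where
    d = walk? (S ++ L) (lo f) (hi f)
    IH = ∈-actives {f ∷ S} b dec e
    ≺f : e ∈ chosen L b → e ≺ f
    ≺f e∈ = All.lookup L≺f (chosen-⊆ L b e∈)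
    ⇒ : (¬ Span (S ++ L) f × e ≡ f) ⊎ e ∈ actives (f ∷ S) L b →
        e ∈ f ∷ chosen L b × ¬ Joined (Around S (f ∷ chosen L b) (f ∷ L) e) e
    ⇒ (inj₁ (¬span , refl)) = here refl , ¬span ∘ walk-map (λ g → to (Around-head true b L≺f g))
    ⇒ (inj₂ e∈) = let e∈B , ¬p = to IH e∈ in
      there e∈B , ¬p ∘ walk-map (λ g → to (Around-shift true (≺f e∈B) g))
    ⇐ : e ∈ f ∷ chosen L b × ¬ Joined (Around S (f ∷ chosen L b) (f ∷ L) e) e →
        (¬ Span (S ++ L) f × e ≡ f) ⊎ e ∈ actives (f ∷ S) L b
    ⇐ (here refl , ¬p) = inj₁ (¬p ∘ walk-map (λ g → from (Around-head true b L≺f g)) , refl)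
    ⇐ (there e∈B , ¬p) = inj₂ (from IH (e∈B , ¬p ∘ walk-map (λ g → from (Around-shift true (≺f e∈B) g))))

  -- Walk criteria for NBC sets and for activity

  Above : EdgePred n → Edge n → EdgePred n
  Above E f g = E g × f ≺ g

  minimum : ∀ {e} xs → e ∈ xs → ∃ λ m → m ∈ xs × (∀ x → x ∈ xs → x ≢ m → m ≺ x)
  minimum (x ∷ []) _ = x , here refl , λ { _ (here refl) x≢x → contradiction refl x≢x }
  minimum (x ∷ y ∷ xs) _ with minimum (y ∷ xs) (here refl)
  ... | m , m∈ , min with compare x m
  ...   | tri< x≺m _ _ = x , here refl , λ
    { _ (here refl) x≢x → contradiction refl x≢x
    ; z (there z∈) _ → below z z∈ }
    where
    below : ∀ z → z ∈ y ∷ xs → x ≺ z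
    below z z∈ with z ≟ᴱ m
    ... | yes refl = x≺m
    ... | no  z≢m  = ≺-trans x≺m (min z z∈ z≢m)
  ...   | tri≈ _ refl _ = m , here refl , λ
    { _ (here refl) x≢x → contradiction refl x≢x ; z (there z∈) → min z z∈ }
  ...   | tri> _ _ m≺x = m , there m∈ , λ { _ (here refl) _ → m≺x ; z (there z∈) → min z z∈ }

  EdgeOfCircle? : ∀ vs (e : Edge n) → Dec (EdgeOfCircle vs e)
  EdgeOfCircle? vs e = ((lo e , hi e) ∈? cycPairs vs) ⊎-dec ((hi e , lo e) ∈? cycPairs vs)
    where open DecMembership (Productₚ.≡-dec Fin._≟_ Fin._≟_) using (_∈?_)

  circle-minimum : ∀ {vs : List (Fin n)} → IsCircle vs →
                   ∃ λ m → EdgeOfCircle vs m × (∀ e → EdgeOfCircle vs e → e ≢ m → m ≺ e)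
  circle-minimum {vs} circle with circle-edge circle
  ... | e , e∈ with minimum edges (∈edges e e∈)
    where
    edges = filter (EdgeOfCircle? vs) (allEdges n)
    ∈edges : ∀ e → EdgeOfCircle vs e → e ∈ edges
    ∈edges e = ∈-filter⁺ (EdgeOfCircle? vs) (∈-allEdges e)
  ...   | m , m∈ , min = m , proj₂ (∈-filter⁻ (EdgeOfCircle? vs) {xs = allEdges n} m∈) ,
                         λ e e∈ → min e (∈-filter⁺ (EdgeOfCircle? vs) (∈-allEdges e) e∈)

  -- A path of edges above `f` between its ends closes with `f` to a circle whose smallest edge is
  -- `f`, so the path is a broken circuit.
  NBCSet⇒¬joined : {E : EdgePred n} → IsNBCSet o E → ∀ f → ¬ Joined (Above E f) f
  NBCSet⇒¬joined (_ , ¬bc) f p with circleThrough (λ (_ , f≺f) → irrefl refl f≺f) p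
  ... | vs , circle , f∈ , rest =
    ¬bc (vs , circle , f , f∈ , (λ e e∈ e≢f → proj₂ (rest e e∈ e≢f)) , λ e e∈ e≢f → proj₁ (rest e e∈ e≢f))

  -- A circle inside `E` and a broken circuit in `E` have the same effect: larger edges of `E` join
  -- the ends of the smallest edge of a circle.
  ¬joined⇒NBCSet : {E : EdgePred n} → (∀ f → ¬ Joined (Above E f) f) → IsNBCSet o E
  ¬joined⇒NBCSet ¬joined =
      (λ vs circle inE → let m , m∈ , min = circle-minimum circle in
         ¬joined m (walk-map (λ e (e∈ , e≢m) → inE e e∈ , min e e∈ e≢m) (circle-rest circle m∈)))
    , (λ (vs , circle , m , m∈ , min , inE) →
         ¬joined m (walk-map (λ e (e∈ , e≢m) → inE e e∈ e≢m , min e e∈ e≢m) (circle-rest circle m∈)))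

  joined? : {E : EdgePred n} → (∀ e → Dec (E e)) → ∀ e → Dec (Joined E e)
  joined? E? e = map′ (walk-map λ g g∈ → proj₂ (∈-filter⁻ E? {xs = allEdges n} g∈))
                      (walk-map λ g Eg → ∈-filter⁺ E? (∈-allEdges g) Eg)
                      (walk? (filter E? (allEdges n)) (lo e) (hi e))

  -- If `e` is the smallest edge of its cocircuit, every smaller edge has its ends joined in
  -- `Minus E e`, as it could be exchanged for `e` otherwise; a walk of the excluded kind would thus
  -- yield a detour around the bridge `e`. Conversely, a smaller `f` in the cocircuit gives a
  -- spanning tree whose edges are all of the excluded kind, and it joins the ends of `e`.
  active⇔ : {E : EdgePred n} → (∀ e → Dec (E e)) → IsSpanningTree E → ∀ e →
            IsActive o E e ⇔ (E e × ¬ Joined (λ g → Above E e g ⊎ g ≺ e) e)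
  active⇔ {E = E} E? tree@(forest , conn) e = mk⇔ ⇒ ⇐
    where
    ⇒ : IsActive o E e → E e × ¬ Joined (λ g → Above E e g ⊎ g ≺ e) e
    ⇒ (Ee , _ , smallest) = Ee , λ p → forest⇒¬joined forest Ee (walk-bind within p)
      where
      within : ∀ g → Above E e g ⊎ g ≺ e → Joined (Minus E e) g
      within g (inj₁ (Eg , e≺g)) = joined-edge (Eg , λ g≡e → irrefl (sym g≡e) e≺g)
      within g (inj₂ g≺e) with joined? (λ h → E? h ×-dec ¬? (h ≟ᴱ e)) g
      ... | yes p = p
      ... | no ¬p = contradiction g≺e
        (asym (smallest g (exchange-tree tree Ee ¬p) (λ g≡e → irrefl g≡e g≺e)))
    ⇐ : E e × ¬ Joined (λ g → Above E e g ⊎ g ≺ e) e → IsActive o E e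
    ⇐ (Ee , ¬p) = Ee , exchange-self tree Ee , smallest
      where
      smallest : ∀ f → InCocircuit E e f → f ≢ e → e ≺ f
      smallest f (_ , conn′) f≢e with compare e f
      ... | tri< e≺f _ _ = e≺f
      ... | tri≈ _ e≡f _ = contradiction (sym e≡f) f≢e
      ... | tri> _ _ f≺e = contradiction (walk-map inside (conn′ (lo e) (hi e))) ¬p
        where
        inside : ∀ g → exchange E e f g → Above E e g ⊎ g ≺ e
        inside g (inj₂ refl) = inj₂ f≺e
        inside g (inj₁ (Eg , g≢e)) with compare e g
        ... | tri< e≺g _ _ = inj₁ (Eg , e≺g)
        ... | tri≈ _ e≡g _ = contradiction (sym e≡g) g≢e
        ... | tri> _ _ g≺e = inj₂ g≺e

  -- The edge set is a predicate `E` equivalent to membership in the chosen list, which allows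
  -- `toPred` of a matrix to be inserted directly.
  module _ {L : List (Edge n)} (dec : Decreasing L) (L! : Unique L) (complete : ∀ e → e ∈ L)
           {E : EdgePred n} (b : Vec Bool (length L)) (E⇔ : ∀ e → E e ⇔ e ∈ chosen L b) where

    E? : ∀ e → Dec (E e)
    E? e = map′ (from (E⇔ e)) (to (E⇔ e)) (DecMembership._∈?_ _≟ᴱ_ e (chosen L b))

    basis⇔ : IsNBCBasis o E ⇔ Admissible [] L b
    basis⇔ = mk⇔
      (λ (nbc , _ , conn) → ⇒Admissible b dec
        (λ f _ p → NBCSet⇒¬joined nbc f
          (walk-map (λ { g (inj₁ ()) ; g (inj₂ (g∈ , f≺g)) → from (E⇔ g) g∈ , f≺g }) p))
        (λ e → walk-map (λ g Eg → inj₂ (to (E⇔ g) Eg)) (conn (lo e) (hi e))))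
      (λ adm →
        let nbc , span = Admissible⇒ b dec adm
            nbcSet = ¬joined⇒NBCSet (λ f p → nbc f (complete f)
              (walk-map (λ g (Eg , f≺g) → inj₂ (to (E⇔ g) Eg , f≺g)) p))
        in nbcSet , proj₁ nbcSet ,
           allJoined⇒Connected (λ e → walk-map (λ { g (inj₁ ()) ; g (inj₂ g∈) → from (E⇔ g) g∈ }) (span e)))

    card-active : IsSpanningTree E → HasCard (IsActive o E) (length (actives [] L b))
    card-active tree =
        actives [] L b
      , actives-Unique [] b L!
      , (λ e → ⇔-sym (active⇔ E? tree e) ⇔-∘ (around e ⇔-∘ ∈-actives b dec e))
      , refl
      where
      around : ∀ e → (e ∈ chosen L b × ¬ Joined (Around [] (chosen L b) L e) e)
                     ⇔ (E e × ¬ Joined (λ g → Above E e g ⊎ g ≺ e) e)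
      around e = mk⇔
        (λ (e∈ , ¬p) → from (E⇔ e) e∈ , ¬p ∘ walk-map
          (λ { g (inj₁ (Eg , e≺g)) → inj₁ (inj₂ (to (E⇔ g) Eg , e≺g))
             ; g (inj₂ g≺e) → inj₂ (complete g , g≺e) }))
        (λ (Ee , ¬p) → to (E⇔ e) Ee , ¬p ∘ walk-map
          (λ { g (inj₁ (inj₁ ()))
             ; g (inj₁ (inj₂ (g∈ , e≺g))) → inj₁ (from (E⇔ g) g∈ , e≺g)
             ; g (inj₂ (_ , g≺e)) → inj₂ g≺e }))

    basisOfActivity⇔ : (IsNBCBasis o E × HasCard (IsActive o E) k)
                       ⇔ (Admissible [] L b × length (actives [] L b) ≡ k)
    basisOfActivity⇔ = mk⇔
      (λ (basis@(_ , tree) , card) → to basis⇔ basis , HasCard-unique (card-active tree) card)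
      (λ { (adm , refl) → let basis = from basis⇔ adm in basis , card-active (proj₂ basis) })

-- Edge sets as Boolean matrices

entry : List (Edge n) → ∀ {i j : Fin n} → Dec (i Fin.< j) → Bool
entry B (no _)    = false
entry B (yes i<j) with DecMembership._∈?_ _≟ᴱ_ (mkEdge _ _ i<j) B
... | yes _ = true
... | no  _ = false

matrixOf : List (Edge n) → EdgeMatrix n
matrixOf B = tabulate λ i → tabulate λ j → entry B (i Finₚ.<? j)

lookup-matrixOf : (B : List (Edge n)) → ∀ i j → lookup (lookup (matrixOf B) i) j ≡ entry B (i Finₚ.<? j)
lookup-matrixOf B i j = trans (cong (λ row → lookup row j) (Vecₚ.lookup∘tabulate _ i)) (Vecₚ.lookup∘tabulate _ j)

entry-true : (B : List (Edge n)) → ∀ e (d : Dec (lo e Fin.< hi e)) → entry B d ≡ true ⇔ e ∈ B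
entry-true B e (no ¬p) = contradiction (lo<hi e) ¬p
entry-true B e (yes p) with DecMembership._∈?_ _≟ᴱ_ (mkEdge _ _ p) B
... | yes e∈ = mk⇔ (λ _ → subst (_∈ B) (edge-ext refl refl) e∈) (λ _ → refl)
... | no  e∉ = mk⇔ (λ ()) (λ e∈ → contradiction (subst (_∈ B) (edge-ext refl refl) e∈) e∉)

toPred-matrixOf : (B : List (Edge n)) → ∀ e → toPred (matrixOf B) e ⇔ e ∈ B
toPred-matrixOf B e = subst (λ c → (c ≡ true) ⇔ e ∈ B) (sym (lookup-matrixOf B (lo e) (hi e)))
                            (entry-true B e (lo e Finₚ.<? hi e))

matrixOf-WellFormed : (B : List (Edge n)) → WellFormedEM (matrixOf B)
matrixOf-WellFormed B i j i≮j rewrite lookup-matrixOf B i j with i Finₚ.<? j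
... | yes i<j = contradiction i<j i≮j
... | no  _   = refl

Bool-ext : ∀ {a b} → (a ≡ true → b ≡ true) → (b ≡ true → a ≡ true) → a ≡ b
Bool-ext {true}  {true}  _ _ = refl
Bool-ext {true}  {false} f _ = sym (f refl)
Bool-ext {false} {true}  _ g = g refl
Bool-ext {false} {false} _ _ = refl

matrixOf-toPred : {M : EdgeMatrix n} → WellFormedEM M → ∀ {B} → (∀ e → toPred M e ⇔ e ∈ B) → matrixOf B ≡ M
matrixOf-toPred {M = M} wf {B} M⇔ = lookup-ext λ i → lookup-ext λ j → same i j
  where
  same : ∀ i j → lookup (lookup (matrixOf B) i) j ≡ lookup (lookup M i) j
  same i j with i Finₚ.<? j
  ... | no  i≮j = trans (matrixOf-WellFormed B i j i≮j) (sym (wf i j i≮j))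
  ... | yes i<j = Bool-ext (from (M⇔ ij) ∘ to (toPred-matrixOf B ij)) (from (toPred-matrixOf B ij) ∘ to (M⇔ ij))
    where ij = mkEdge i j i<j

card-NBCBasis : ∀ m k (o : EdgeOrder (suc m)) → HasCard (NBCBasisOfActivity o k) (rising m k)
card-NBCBasis m k o =
  HasCard-bij (matrixOf ∘ chosen L)
    (λ b Pb → matrixOf-WellFormed (chosen L b) ,
              from (basisOfActivity⇔ dec L! complete b (toPred-matrixOf (chosen L b))) Pb)
    (λ {b} {b′} _ _ eq → chosen-injective L! b b′ (same eq) (same (sym eq)))
    surj
    (subst (HasCard _) (trans (T-↭ L↭ [] k) (T-allEdges m k)) (card-Admissible [] L k))
  where
  open Ordered o
  sorted = sortDecreasing (edgesBelow-Unique ℕₚ.≤-refl)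
  L   = proj₁ sorted
  L↭  = proj₁ (proj₂ sorted)
  dec = proj₂ (proj₂ sorted)
  L! : Unique L
  L! = Unique-resp-↭ (Perm.↭-sym L↭) (edgesBelow-Unique ℕₚ.≤-refl)
  complete : ∀ e → e ∈ L
  complete e = ∈-resp-↭ (Perm.↭-sym L↭) (∈-allEdges e)
  same : ∀ {B B′} → matrixOf B ≡ matrixOf B′ → ∀ e → e ∈ B → e ∈ B′
  same {B} {B′} eq e e∈ = to (toPred-matrixOf B′ e) (subst (λ M → toPred M e) eq (from (toPred-matrixOf B e) e∈))
  surj : ∀ M → NBCBasisOfActivity o k M →
         ∃ λ b → (Admissible [] L b × length (actives [] L b) ≡ k) × matrixOf (chosen L b) ≡ M
  surj M (wf , PM) = b , to (basisOfActivity⇔ dec L! complete b M⇔) PM , matrixOf-toPred wf M⇔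
    where
    p : Edge (suc m) → Bool
    p e = lookup (lookup M (lo e)) (hi e)
    b = choose p L
    M⇔ : ∀ e → toPred M e ⇔ e ∈ chosen L b
    M⇔ e = mk⇔ (∈-choose⁺ p (complete e)) (∈-choose⁻ p L)

theorem5p1 : (n : ℕ) → 2 ≤ n → (k : ℕ) → (o : EdgeOrder n) →
    Σ ℕ λ m →
    HasCard (NBCBasisOfActivity o k) m ×
    HasCard (IncRootDeg {n} k) m ×
    HasCard (DecRootDeg n k) m ×
    HasCard (DecAdjEdges {n} k) m ×
    (+ m ≡ unsignedStirlingExpr n k)
theorem5p1 (suc m) _ k o =
    rising m k
  , card-NBCBasis m k o
  , card-IncRootDeg m k
  , card-DecRootDeg m k
  , card-DecAdjEdges m k
  , rising≡stirling m k
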